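{- Let $\mathcal A$ be a laminar family of partial cuts on $S$, and let $(G,S,c)$ be an inner Eulerian network. Suppose the Eulerian condition is fulfilled by each terminal $s$ for which there exist $(A,B),(A',B')\in\mathcal A$ with $s\notin A\cup B\cup A'\cup B'$ and either ($A\subseteq B'$ and $A'\subseteq B$) or ($B\subseteq A'$ and $B'\subseteq A$). Then there is an integral multiflow locking $\mathcal A$.
   Context: A network $(G,S,c)$: finite digraph $G=(VG,EG)$, terminals $S\subseteq VG$, capacity $c:EG\to\mathbb Z_+$. A multiflow is a set $\mathcal P$ of directed paths joining distinct terminals with $\lambda:\mathcal P\to\mathbb R_+$, $\sum_{P\ni e}\lambda(P)\le c(e)$; integral if $\lambda$ is integer-valued. A node fulfills the Eulerian condition if its outgoing capacity equals its incoming capacity; the network is inner Eulerian if every non-terminal node does. A partial cut on $S$ is an ordered pair $(A,B)$ of disjoint subsets of $S$; an $(A,B)$-flow is a multiflow whose paths go from a node of $A$ to a node of $B$ (its value is the total $\lambda$), and a maximum $(A,B)$-flow is a multiflow maximizing $\sum_P\lambda(P)\delta_{A,B}(s_P,t_P)$, where $\delta_{A,B}(s,t)=1$ if $(s,t)\in A\times B$ and $0$ otherwise. A multiflow locks $\mathcal A$ if it is simultaneously a maximum $(A,B)$-flow for every $(A,B)\in\mathcal A$. Two partial cuts $(A,B),(A',B')$ are laminar if $A\subseteq A',B\supseteq B'$, or $A\subseteq B',B\supseteq A'$, or $A\supseteq A',B\subseteq B'$, or $A\supseteq B',B\subseteq A'$; a family is laminar if every pair is.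
   Formalization: The weights λ of multiflows are rational instead of real, so the integral multiflow is shown to be a maximum (A,B)-flow among all multiflows with rational weights. -}

module Defs where

open import Data.Nat using (ℕ; zero; suc)
import Data.Nat as ℕ
open import Data.Integer using (+_)
open import Data.Rational using (ℚ; 0ℚ; _/_) renaming (_+_ to _+ℚ_; _*_ to _*ℚ_; _≤_ to _≤ℚ_)
open import Data.Fin using (Fin; _≟_)
open import Data.Fin.Subset using (Subset; _∈_; _∉_; _⊆_; _∪_)
open import Data.Vec using (lookup)
open import Data.Bool using (Bool; true; false; _∧_; if_then_else_)
open import Data.List using (List; []; _∷_; map)
open import Data.List.Relation.Unary.All using (All)
open import Data.List.Relation.Unary.Unique.Propositional using (Unique)
open import Data.List.Relation.Unary.Linked using (Linked)
open import Data.List.Membership.Propositional using () renaming (_∈_ to _∈L_)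
open import Data.Product using (Σ; _×_; _,_; proj₁; proj₂; ∃)
open import Data.Sum using (_⊎_)
open import Relation.Binary.PropositionalEquality using (_≡_; _≢_)
open import Relation.Nullary using (¬_; yes; no)

record Network : Set where
  field
    n    : ℕ
    m    : ℕ
    tail : Fin m → Fin n
    head : Fin m → Fin n
    S    : Subset n
    c    : Fin m → ℕ

sumFin : ∀ {k} → (Fin k → ℕ) → ℕ
sumFin {zero}  f = 0
sumFin {suc k} f = f Fin.zero ℕ.+ sumFin (λ i → f (Fin.suc i))
  where import Data.Fin as Fin

sumℚ : List ℚ → ℚ
sumℚ []       = 0ℚ
sumℚ (x ∷ xs) = x +ℚ sumℚ xs

ℕ→ℚ : ℕ → ℚ
ℕ→ℚ k = (+ k) / 1

module _ (N : Network) where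
  open Network N

  outCap : Fin n → ℕ
  outCap v = sumFin (λ e → if ⌊ tail e ≟ v ⌋ then c e else 0)
    where open import Relation.Nullary.Decidable using (⌊_⌋)

  inCap : Fin n → ℕ
  inCap v = sumFin (λ e → if ⌊ head e ≟ v ⌋ then c e else 0)
    where open import Relation.Nullary.Decidable using (⌊_⌋)

  Eulerian : Fin n → Set
  Eulerian v = outCap v ≡ inCap v

  InnerEulerian : Set
  InnerEulerian = ∀ v → v ∉ S → Eulerian v

  lastEdge : Fin m → List (Fin m) → Fin m
  lastEdge e []       = e
  lastEdge e (f ∷ fs) = lastEdge f fs

  record Path : Set where
    field
      first  : Fin m
      rest   : List (Fin m)
      linked : Linked (λ e f → head e ≡ tail f) (first ∷ rest)
      simple : Unique (tail first ∷ map head (first ∷ rest))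

    edges : List (Fin m)
    edges = first ∷ rest

    source : Fin n
    source = tail first

    target : Fin n
    target = head (lastEdge first rest)

  open Path public

  occ : Fin m → List (Fin m) → ℕ
  occ e []       = 0
  occ e (f ∷ fs) with e ≟ f
  ... | yes _ = suc (occ e fs)
  ... | no  _ = occ e fs

  Flow : Set
  Flow = List (Path × ℚ)

  load : Flow → Fin m → ℚ
  load F e = sumℚ (map (λ pw → proj₂ pw *ℚ ℕ→ℚ (occ e (edges (proj₁ pw)))) F)

  IsMultiflow : Flow → Set
  IsMultiflow F =
    All (λ pw → (source (proj₁ pw) ∈ S) × (target (proj₁ pw) ∈ S)
              × (source (proj₁ pw) ≢ target (proj₁ pw))
              × (0ℚ ≤ℚ proj₂ pw)) F
    × (∀ e → load F e ≤ℚ ℕ→ℚ (c e))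

  IsIntegral : Flow → Set
  IsIntegral F = All (λ pw → ∃ λ k → proj₂ pw ≡ ℕ→ℚ k) F

  PartialCut : Set
  PartialCut = Subset n × Subset n

  IsPartialCut : PartialCut → Set
  IsPartialCut (A , B) = A ⊆ S × B ⊆ S × (∀ {x} → x ∈ A → x ∉ B)

  δ : PartialCut → Fin n → Fin n → Bool
  δ (A , B) s t = lookup A s ∧ lookup B t

  value : PartialCut → Flow → ℚ
  value AB F = sumℚ (map (λ pw → if δ AB (source (proj₁ pw)) (target (proj₁ pw))
                                 then proj₂ pw else 0ℚ) F)

  IsMaxFlow : PartialCut → Flow → Set
  IsMaxFlow AB F = IsMultiflow F × (∀ F′ → IsMultiflow F′ → value AB F′ ≤ℚ value AB F)

  Locks : List PartialCut → Flow → Set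
  Locks 𝒜 F = ∀ {AB} → AB ∈L 𝒜 → IsMaxFlow AB F

Laminar₂ : ∀ {n} → Subset n × Subset n → Subset n × Subset n → Set
Laminar₂ (A , B) (A′ , B′) =
    (A ⊆ A′ × B′ ⊆ B) ⊎ (A ⊆ B′ × A′ ⊆ B)
  ⊎ (A′ ⊆ A × B ⊆ B′) ⊎ (B′ ⊆ A × B ⊆ A′)

Laminar : ∀ {n} → List (Subset n × Subset n) → Set
Laminar 𝒜 = ∀ {X Y} → X ∈L 𝒜 → Y ∈L 𝒜 → Laminar₂ X Y

Special : ∀ {n} → List (Subset n × Subset n) → Fin n → Set
Special 𝒜 s = ∃ λ A → ∃ λ B → ∃ λ A′ → ∃ λ B′ →
  (A , B) ∈L 𝒜 × (A′ , B′) ∈L 𝒜 × s ∉ (A ∪ B ∪ A′ ∪ B′)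
  × ((A ⊆ B′ × A′ ⊆ B) ⊎ (B ⊆ A′ × B′ ⊆ A))

{-# OPTIONS --safe #-}
-- Keep a list of walks of G, each used one unit, starting from c(e) copies of every edge e. Concatenating a walk
-- u → v with a walk v → w splits off a pair of arcs at v. For each cut (A,B) of the family let M be a minimum
-- A-B cut of the original network, of size κ. As long as some arc e = (u,v) leaves M with v ∉ B, one can split off
-- e with some arc (v,w) and keep every A-B cut of size ≥ κ, for all cuts of the family; dually if u ∉ A. At the
-- end all arcs leaving M go directly from A to B, so the walks form a flow of value κ for every cut at once.
--
-- A pair (u,v), (v,w) that cannot be split off has a witness: a tight set meeting {u,v,w} in {u,w} or in {v}.
-- Because the arc e lies between them, witnesses with u inside can be united, and those with v inside can be
-- intersected; one is left with tight sets X (u inside, v outside) and Y (v inside, u outside) such that each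
-- out-neighbour w of v lies in X or outside Y. Laminarity allows only two positions of their partial cuts: in one,
-- Y ∖ X is tight, contains v but none of the w, and gets smaller by removing v; in the other, X ∪ ∁Y is tight,
-- contains every w but not v, and gets smaller by adding v. The Eulerian hypothesis is what makes X ∖ Y and
-- Y ∖ X (or their co-versions) tight, and what makes removing v an improvement.

module Submission where

open import Defs
open import Algebra.Bundles using (module CommutativeMonoid)
open import Algebra.Properties.CommutativeSemigroup using (interchange)
open import Data.Bool using (Bool; true; false; _∧_; _∨_; not; T; if_then_else_)
open import Data.Bool.Properties using (T-∧; ∧-zeroʳ)
open import Data.Empty using (⊥; ⊥-elim)
open import Data.Fin using (Fin; zero; suc; _≟_)
open import Data.Fin.Subset using (Subset; _∈_; _∉_; _⊆_; _∪_)
open import Data.Fin.Subset.Properties using (_∈?_; x∈p∪q⁻)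
import Data.Integer as ℤ
import Data.Integer.Properties as ℤ
open import Data.List using (List; []; _∷_; map; _++_; allFin; length; replicate)
import Data.List as List
import Data.List.Membership.DecPropositional as DecMembership
open import Data.List.Membership.Propositional using () renaming (_∈_ to _∈L_)
open import Data.List.Membership.Propositional.Properties using (∈-allFin; ∈-∃++; ∈-lookup)
open import Data.List.Relation.Binary.Permutation.Propositional using (_↭_; ↭-trans; ↭-refl; prep)
open import Data.List.Relation.Binary.Permutation.Propositional.Properties
  using (map⁺; shift; ∈-resp-↭; ↭-length)
open import Data.List.Relation.Unary.All using (All; []; _∷_)
import Data.List.Relation.Unary.All as All
open import Data.List.Relation.Unary.All.Properties using (¬Any⇒All¬)
open import Data.List.Relation.Unary.AllPairs using ([]; _∷_)
open import Data.List.Relation.Unary.Any using (here; there; index)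
open import Data.List.Relation.Unary.Any.Properties using (lookup-index)
open import Data.List.Relation.Unary.Linked using (Linked; [-]; _∷_)
open import Data.List.Relation.Unary.Unique.Propositional using (Unique)
open import Data.Nat using (ℕ; zero; suc; _+_; _*_; _≤_; _<_; _≤ᵇ_; z≤n; s≤s)
open import Data.Nat.ListAction using (sum)
open import Data.Nat.ListAction.Properties using (sum-↭)
open import Data.Nat.Properties hiding (_≟_)
open import Data.Product using (Σ; _×_; _,_; proj₁; proj₂; ∃; ∃₂)
open import Data.Rational using (ℚ; 0ℚ; 1ℚ) renaming (_+_ to _+ℚ_; _*_ to _*ℚ_; _≤_ to _≤ℚ_)
import Data.Rational as ℚ
import Data.Rational.Properties as ℚ
import Data.Rational.Unnormalised as ℚᵘ
import Data.Rational.Unnormalised.Properties as ℚᵘ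
open import Data.Sum using (_⊎_; inj₁; inj₂; map₁; map₂; swap; [_,_]′)
open import Data.Vec using (lookup)
open import Data.Vec.Properties using ([]=⇒lookup; lookup⇒[]=)
import Data.Vec.Functional as Vector
open import Function using (_∘_; case_of_; Equivalence)
open import Relation.Binary.PropositionalEquality
open import Relation.Nullary using (¬_; yes; no; Dec; ¬?; _×-dec_)
open import Relation.Nullary.Decidable using (⌊_⌋)

-- Sums over lists and inequalities between Boolean expressions.

⟦_⟧ : Bool → ℕ
⟦ true ⟧  = 1
⟦ false ⟧ = 0

total : {W : Set} → (W → ℕ) → List W → ℕ
total f L = sum (map f L)

total-mono : {W : Set} {f g : W → ℕ} (L : List W) →
  (∀ {a} → a ∈L L → f a ≤ g a) → total f L ≤ total g L
total-mono []      f≤g = z≤n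
total-mono (a ∷ L) f≤g = +-mono-≤ (f≤g (here refl)) (total-mono L (f≤g ∘ there))

total-mono-< : {W : Set} {f g : W → ℕ} {e : W} (L : List W) →
  (∀ {a} → a ∈L L → f a ≤ g a) → e ∈L L → f e < g e → total f L < total g L
total-mono-< (a ∷ L) f≤g (here refl) fe<ge = +-mono-<-≤ fe<ge (total-mono L (f≤g ∘ there))
total-mono-< (a ∷ L) f≤g (there e∈L) fe<ge =
  +-mono-≤-< (f≤g (here refl)) (total-mono-< L (f≤g ∘ there) e∈L fe<ge)

total-cong : {W : Set} {f g : W → ℕ} → (∀ a → f a ≡ g a) → (L : List W) → total f L ≡ total g L
total-cong f≗g []      = refl
total-cong f≗g (a ∷ L) = cong₂ _+_ (f≗g a) (total-cong f≗g L)

total-+ : {W : Set} (f g : W → ℕ) (L : List W) → total (λ a → f a + g a) L ≡ total f L + total g L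
total-+ f g []      = refl
total-+ f g (a ∷ L) = trans (cong (f a + g a +_) (total-+ f g L))
                            (interchange +-commutativeSemigroup (f a) (g a) _ _)

∀𝔹 : (Bool → Bool) → Bool
∀𝔹 f = f true ∧ f false

∀𝔹-sound : (f : Bool → Bool) → T (∀𝔹 f) → ∀ b → T (f b)
∀𝔹-sound f p true  = proj₁ (Equivalence.to T-∧ p)
∀𝔹-sound f p false = proj₂ (Equivalence.to T-∧ p)

-- The cut inequalities are proved arc by arc, and a single arc matters only through the membership
-- of its two ends in two regions. The sixteen cases are settled by evaluation, so callers pass `_`
-- for the proof.
≤-by-cases : (f g : Bool → Bool → Bool → Bool → ℕ) →
  T (∀𝔹 λ a → ∀𝔹 λ b → ∀𝔹 λ c → ∀𝔹 λ d → f a b c d ≤ᵇ g a b c d) →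
  ∀ a b c d → f a b c d ≤ g a b c d
≤-by-cases f g p a b c d =
  ≤ᵇ⇒≤ _ _ (∀𝔹-sound (h a b c)
    (∀𝔹-sound (λ c → ∀𝔹 (h a b c))
      (∀𝔹-sound (λ b → ∀𝔹 λ c → ∀𝔹 (h a b c))
        (∀𝔹-sound (λ a → ∀𝔹 λ b → ∀𝔹 λ c → ∀𝔹 (h a b c)) p a) b) c) d)
  where
  h : Bool → Bool → Bool → Bool → Bool
  h a b c d = f a b c d ≤ᵇ g a b c d

-- Regions, separation and cut sizes.

Region : ℕ → Set
Region n = Fin n → Bool

_⊑_ : ∀ {n} → Region n → Region n → Set
X ⊑ Y = ∀ x → X x ≡ true → Y x ≡ true

_∩ᵣ_ _∪ᵣ_ _∖ᵣ_ : ∀ {n} → Region n → Region n → Region n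
(X ∩ᵣ Y) x = X x ∧ Y x
(X ∪ᵣ Y) x = X x ∨ Y x
(X ∖ᵣ Y) x = X x ∧ not (Y x)

∁ᵣ : ∀ {n} → Region n → Region n
∁ᵣ X x = not (X x)

｛_｝ : ∀ {n} → Fin n → Region n
｛ v ｝ x = ⌊ x ≟ v ⌋

Separates : ∀ {n} → Region n → Region n → Region n → Set
Separates A B X = A ⊑ X × (B ⊑ ∁ᵣ X)

LaminarPair : ∀ {n} → Region n → Region n → Region n → Region n → Set
LaminarPair A B A′ B′ = (A ⊑ A′ × B′ ⊑ B) ⊎ (A ⊑ B′ × A′ ⊑ B) ⊎ (A′ ⊑ A × B ⊑ B′) ⊎ (B′ ⊑ A × B ⊑ A′)

-- The two laminar positions in which a source side lies in the other pair's sink side, or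
-- conversely. They are the positions for which the theorem assumes the Eulerian condition.
Opposite : ∀ {n} → Region n → Region n → Region n → Region n → Set
Opposite A B A′ B′ = (A ⊑ B′ × A′ ⊑ B) ⊎ (B ⊑ A′ × B′ ⊑ A)

Outside : ∀ {n} → Region n → Region n → Region n → Region n → Fin n → Set
Outside A B A′ B′ x = A x ≡ false × B x ≡ false × A′ x ≡ false × B′ x ≡ false

-- The end maps are arguments, so that all arcs are reversed by exchanging `src` and `tgt`.
crossing : {W : Set} {n : ℕ} → (W → Fin n) → (W → Fin n) → Region n → W → ℕ
crossing src tgt X a = ⟦ X (src a) ∧ not (X (tgt a)) ⟧

cutSize : {W : Set} {n : ℕ} → (W → Fin n) → (W → Fin n) → Region n → List W → ℕ
cutSize src tgt X = total (crossing src tgt X)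

not-true : ∀ {b} → not b ≡ true → b ≡ false
not-true {false} _ = refl

contrapose : ∀ {n} {X Y : Region n} {x} → X ⊑ Y → Y x ≡ false → X x ≡ false
contrapose {X = X} {x = x} X⊑Y Yx with X x in Xx
... | false = refl
... | true  = case trans (sym (X⊑Y x Xx)) Yx of λ ()

true≢false : ∀ {b} → b ≡ true → b ≡ false → ⊥
true≢false refl ()

∧-true : ∀ {a b} → a ≡ true → b ≡ true → a ∧ b ≡ true
∧-true refl refl = refl

∨-trueˡ : ∀ {a b} → a ≡ true → a ∨ b ≡ true
∨-trueˡ refl = refl

∨-trueʳ : ∀ {a b} → b ≡ true → a ∨ b ≡ true
∨-trueʳ {true}  _ = refl
∨-trueʳ {false} p = p

∧-elimˡ : ∀ {a b} → a ∧ b ≡ true → a ≡ true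
∧-elimˡ {true} _ = refl

∧-elimʳ : ∀ {a b} → a ∧ b ≡ true → b ≡ true
∧-elimʳ {true} p = p

not-intro : ∀ {b} → b ≡ false → not b ≡ true
not-intro refl = refl

∧-falseˡ : ∀ {a b} → a ≡ false → not (a ∧ b) ≡ true
∧-falseˡ refl = refl

∧-falseʳ : ∀ {a b} → b ≡ false → not (a ∧ b) ≡ true
∧-falseʳ {true}  refl = refl
∧-falseʳ {false} _    = refl

∨-false : ∀ {a b} → a ≡ false → b ≡ false → not (a ∨ b) ≡ true
∨-false refl refl = refl

∈-singleton : ∀ {n} (v : Fin n) → ｛ v ｝ v ≡ true
∈-singleton v with v ≟ v
... | yes _ = refl
... | no v≢v = ⊥-elim (v≢v refl)

singleton-elim : ∀ {n} {v x : Fin n} → ｛ v ｝ x ≡ true → x ≡ v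
singleton-elim {v = v} {x} p with x ≟ v
... | yes x≡v = x≡v

-- Uncrossing tight regions.

module Uncrossing {n : ℕ} {W I : Set} (src tgt : W → Fin n) (A B : I → Region n) (κ : I → ℕ)
  (L : List W)
  (laminar : ∀ i j → LaminarPair (A i) (B i) (A j) (B j))
  (lower : ∀ i X → Separates (A i) (B i) X → κ i ≤ cutSize src tgt X L)
  (balance : ∀ i j → Opposite (A i) (B i) (A j) (B j) →
    ∀ (Z : Region n) → (∀ x → Z x ≡ true → Outside (A i) (B i) (A j) (B j) x) →
    total (λ a → ⟦ Z (src a) ⟧) L ≡ total (λ a → ⟦ Z (tgt a) ⟧) L)
  where

  δ⁺ : Region n → W → ℕ
  δ⁺ = crossing src tgt

  cut : Region n → ℕ
  cut X = cutSize src tgt X L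

  -- Together with `lower`, the field `minimum` is an equality: tight regions are minimum cuts of
  -- value `κ i`.
  record Tight (i : I) (X : Region n) : Set where
    constructor tight
    field
      separates : Separates (A i) (B i) X
      minimum   : cut X ≤ κ i
  open Tight

  total₃ : (f g h : W → ℕ) → total (λ a → f a + g a + h a) L ≡ total f L + total g L + total h L
  total₃ f g h = trans (total-+ (λ a → f a + g a) h L) (cong (_+ total h L) (total-+ f g L))

  -- One scheme for all uncrossing inequalities. The corrections `s` and `t` have equal totals and
  -- cancel; since `P` and `Q` separate again, their cuts sum to at least `κ i + κ j`, and equality
  -- holds throughout.
  module _ {i j : I} {X Y P Q : Region n} (s t : W → ℕ)
    (balanced : total s L ≡ total t L)
    (pointwise : ∀ a → δ⁺ P a + δ⁺ Q a + s a ≤ δ⁺ X a + δ⁺ Y a + t a)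
    (sepP : Separates (A i) (B i) P) (sepQ : Separates (A j) (B j) Q)
    (tX : Tight i X) (tY : Tight j Y)
    where

    private
      cut+cut≤ : cut P + cut Q ≤ cut X + cut Y
      cut+cut≤ = +-cancelʳ-≤ (total s L) _ _ (begin
        cut P + cut Q + total s L                      ≡⟨ total₃ (δ⁺ P) (δ⁺ Q) s ⟨
        total (λ a → δ⁺ P a + δ⁺ Q a + s a) L         ≤⟨ total-mono L (λ {a} _ → pointwise a) ⟩
        total (λ a → δ⁺ X a + δ⁺ Y a + t a) L         ≡⟨ total₃ (δ⁺ X) (δ⁺ Y) t ⟩
        cut X + cut Y + total t L                      ≡⟨ cong (cut X + cut Y +_) balanced ⟨
        cut X + cut Y + total s L                      ∎)
        where open ≤-Reasoning hiding (strict)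

    uncrossˡ : Tight i P
    uncrossˡ = tight sepP (+-cancelʳ-≤ (κ j) _ _ (begin
      cut P + κ j      ≤⟨ +-monoʳ-≤ (cut P) (lower j Q sepQ) ⟩
      cut P + cut Q    ≤⟨ cut+cut≤ ⟩
      cut X + cut Y    ≤⟨ +-mono-≤ (minimum tX) (minimum tY) ⟩
      κ i + κ j        ∎))
      where open ≤-Reasoning hiding (strict)

    uncrossʳ : Tight j Q
    uncrossʳ = tight sepQ (+-cancelˡ-≤ (κ i) _ _ (begin
      κ i + cut Q      ≤⟨ +-monoˡ-≤ (cut Q) (lower i P sepP) ⟩
      cut P + cut Q    ≤⟨ cut+cut≤ ⟩
      cut X + cut Y    ≤⟨ +-mono-≤ (minimum tX) (minimum tY) ⟩
      κ i + κ j        ∎))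
      where open ≤-Reasoning hiding (strict)

    -- Equal totals force equality at every arc of the list, so one arc with a strict inequality is
    -- contradictory. It is applied below to the arc that is to be split off.
    uncross-strict : ∀ {e} → e ∈L L → δ⁺ P e + δ⁺ Q e + s e < δ⁺ X e + δ⁺ Y e + t e → ⊥
    uncross-strict e∈L e< = <-irrefl refl (begin-strict
        κ i + κ j + total s L
          ≤⟨ +-monoˡ-≤ (total s L) (+-mono-≤ (lower i P sepP) (lower j Q sepQ)) ⟩
        cut P + cut Q + total s L                      ≡⟨ total₃ (δ⁺ P) (δ⁺ Q) s ⟨
        total (λ a → δ⁺ P a + δ⁺ Q a + s a) L         <⟨ total-mono-< L (λ {a} _ → pointwise a) e∈L e< ⟩
        total (λ a → δ⁺ X a + δ⁺ Y a + t a) L         ≡⟨ total₃ (δ⁺ X) (δ⁺ Y) t ⟩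
        cut X + cut Y + total t L                      ≡⟨ cong (cut X + cut Y +_) balanced ⟨
        cut X + cut Y + total s L                      ≤⟨ +-monoˡ-≤ (total s L) (+-mono-≤ (minimum tX) (minimum tY)) ⟩
        κ i + κ j + total s L                          ∎)
        where open ≤-Reasoning hiding (strict)

  zeroes : W → ℕ
  zeroes _ = 0

  -- Submodularity of the cut function; the summand 0 is the correction `zeroes`.
  ∩∪-pointwise : ∀ X Y a →
    δ⁺ (X ∩ᵣ Y) a + δ⁺ (X ∪ᵣ Y) a + 0 ≤ δ⁺ X a + δ⁺ Y a + 0
  ∩∪-pointwise X Y a = ≤-by-cases
    (λ xa ya xb yb → ⟦ (xa ∧ ya) ∧ not (xb ∧ yb) ⟧ + ⟦ (xa ∨ ya) ∧ not (xb ∨ yb) ⟧ + 0)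
    (λ xa ya xb yb → ⟦ xa ∧ not xb ⟧ + ⟦ ya ∧ not yb ⟧ + 0) _
    (X (src a)) (Y (src a)) (X (tgt a)) (Y (tgt a))

  -- Posimodularity up to the net outflow of X ∩ Y, whose two terms are put on opposite sides to avoid subtraction.
  ∖-pointwise : ∀ X Y a →
    δ⁺ (X ∖ᵣ Y) a + δ⁺ (Y ∖ᵣ X) a + ⟦ (X ∩ᵣ Y) (src a) ⟧ ≤ δ⁺ X a + δ⁺ Y a + ⟦ (X ∩ᵣ Y) (tgt a) ⟧
  ∖-pointwise X Y a = ≤-by-cases
    (λ xa ya xb yb → ⟦ (xa ∧ not ya) ∧ not (xb ∧ not yb) ⟧ + ⟦ (ya ∧ not xa) ∧ not (yb ∧ not xb) ⟧ + ⟦ xa ∧ ya ⟧)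
    (λ xa ya xb yb → ⟦ xa ∧ not xb ⟧ + ⟦ ya ∧ not yb ⟧ + ⟦ xb ∧ yb ⟧) _
    (X (src a)) (Y (src a)) (X (tgt a)) (Y (tgt a))

  -- The previous inequality for the complements of `X` and `Y` with all arcs reversed, which is why
  -- the correction terms sit at exchanged ends.
  ∪∁-pointwise : ∀ X Y a →
    δ⁺ (X ∪ᵣ ∁ᵣ Y) a + δ⁺ (Y ∪ᵣ ∁ᵣ X) a + ⟦ ∁ᵣ (X ∪ᵣ Y) (tgt a) ⟧
      ≤ δ⁺ X a + δ⁺ Y a + ⟦ ∁ᵣ (X ∪ᵣ Y) (src a) ⟧
  ∪∁-pointwise X Y a = ≤-by-cases
    (λ xa ya xb yb → ⟦ (xa ∨ not ya) ∧ not (xb ∨ not yb) ⟧ + ⟦ (ya ∨ not xa) ∧ not (yb ∨ not xb) ⟧ + ⟦ not (xb ∨ yb) ⟧)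
    (λ xa ya xb yb → ⟦ xa ∧ not xb ⟧ + ⟦ ya ∧ not yb ⟧ + ⟦ not (xa ∨ ya) ⟧) _
    (X (src a)) (Y (src a)) (X (tgt a)) (Y (tgt a))

  module Nested {i j} (Ai⊑Aj : A i ⊑ A j) (Bj⊑Bi : B j ⊑ B i) {X Y} (tX : Tight i X) (tY : Tight j Y) where

    private
      sep∩ : Separates (A i) (B i) (X ∩ᵣ Y)
      sep∩ = (λ x a → ∧-true (proj₁ (separates tX) x a) (proj₁ (separates tY) x (Ai⊑Aj x a)))
           , (λ x b → ∧-falseˡ (not-true (proj₂ (separates tX) x b)))

      sep∪ : Separates (A j) (B j) (X ∪ᵣ Y)
      sep∪ = (λ x a → ∨-trueʳ (proj₁ (separates tY) x a))
           , (λ x b → ∨-false (not-true (proj₂ (separates tX) x (Bj⊑Bi x b))) (not-true (proj₂ (separates tY) x b)))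

    ∩-tight : Tight i (X ∩ᵣ Y)
    ∩-tight = uncrossˡ zeroes zeroes refl (∩∪-pointwise X Y) sep∩ sep∪ tX tY

    ∪-tight : Tight j (X ∪ᵣ Y)
    ∪-tight = uncrossʳ zeroes zeroes refl (∩∪-pointwise X Y) sep∩ sep∪ tX tY

    ∩∪-strict : ∀ {e} → e ∈L L → δ⁺ (X ∩ᵣ Y) e + δ⁺ (X ∪ᵣ Y) e + 0 < δ⁺ X e + δ⁺ Y e + 0 → ⊥
    ∩∪-strict = uncross-strict zeroes zeroes refl (∩∪-pointwise X Y) sep∩ sep∪ tX tY

  -- Neither intersection nor union need separate here, but the differences do. `X` avoids `B i`,
  -- hence `A j`, and `Y` avoids `B j`, hence `A i`; so `X ∩ᵣ Y` meets none of the four sides and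
  -- its net outflow vanishes.
  module Disjoint {i j} (Ai⊑Bj : A i ⊑ B j) (Aj⊑Bi : A j ⊑ B i) {X Y} (tX : Tight i X) (tY : Tight j Y) where

    private
      outside : ∀ x → (X ∩ᵣ Y) x ≡ true → Outside (A i) (B i) (A j) (B j) x
      outside x p = contrapose Ai⊑Bj x∉Bj , x∉Bi , contrapose Aj⊑Bi x∉Bi , x∉Bj
        where
        x∉Bi = contrapose (proj₂ (separates tX)) (cong not (∧-elimˡ p))
        x∉Bj = contrapose (proj₂ (separates tY)) (cong not (∧-elimʳ {X x} p))

      sepˡ : Separates (A i) (B i) (X ∖ᵣ Y)
      sepˡ = (λ x a → ∧-true (proj₁ (separates tX) x a) (proj₂ (separates tY) x (Ai⊑Bj x a)))
           , (λ x b → ∧-falseˡ (not-true (proj₂ (separates tX) x b)))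

      sepʳ : Separates (A j) (B j) (Y ∖ᵣ X)
      sepʳ = (λ x a → ∧-true (proj₁ (separates tY) x a) (proj₂ (separates tX) x (Aj⊑Bi x a)))
           , (λ x b → ∧-falseˡ (not-true (proj₂ (separates tY) x b)))

      bal = balance i j (inj₁ (Ai⊑Bj , Aj⊑Bi)) (X ∩ᵣ Y) outside

    ∖-tight : Tight j (Y ∖ᵣ X)
    ∖-tight = uncrossʳ _ _ bal (∖-pointwise X Y) sepˡ sepʳ tX tY

    ∖-strict : ∀ {e} → e ∈L L →
      δ⁺ (X ∖ᵣ Y) e + δ⁺ (Y ∖ᵣ X) e + ⟦ (X ∩ᵣ Y) (src e) ⟧ < δ⁺ X e + δ⁺ Y e + ⟦ (X ∩ᵣ Y) (tgt e) ⟧ → ⊥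
    ∖-strict = uncross-strict _ _ bal (∖-pointwise X Y) sepˡ sepʳ tX tY

  -- The dual position: a node outside both `X` and `Y` is outside `A i` and `A j`, hence outside
  -- `B j` and `B i`, so the complement of the union is balanced.
  module Codisjoint {i j} (Bj⊑Ai : B j ⊑ A i) (Bi⊑Aj : B i ⊑ A j) {X Y} (tX : Tight i X) (tY : Tight j Y) where

    private
      outside : ∀ x → ∁ᵣ (X ∪ᵣ Y) x ≡ true → Outside (A i) (B i) (A j) (B j) x
      outside x p with X x in Xx | Y x in Yx
      ... | false | false = x∉Ai , contrapose Bi⊑Aj x∉Aj , x∉Aj , contrapose Bj⊑Ai x∉Ai
        where
        x∉Ai = contrapose (proj₁ (separates tX)) Xx
        x∉Aj = contrapose (proj₁ (separates tY)) Yx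

      sepˡ : Separates (A i) (B i) (X ∪ᵣ ∁ᵣ Y)
      sepˡ = (λ x a → ∨-trueˡ (proj₁ (separates tX) x a))
           , (λ x b → ∨-false (not-true (proj₂ (separates tX) x b)) (cong not (proj₁ (separates tY) x (Bi⊑Aj x b))))

      sepʳ : Separates (A j) (B j) (Y ∪ᵣ ∁ᵣ X)
      sepʳ = (λ x a → ∨-trueˡ (proj₁ (separates tY) x a))
           , (λ x b → ∨-false (not-true (proj₂ (separates tY) x b)) (cong not (proj₁ (separates tX) x (Bj⊑Ai x b))))

      bal = sym (balance i j (inj₂ (Bi⊑Aj , Bj⊑Ai)) (∁ᵣ (X ∪ᵣ Y)) outside)

    ∪∁-tight : Tight i (X ∪ᵣ ∁ᵣ Y)
    ∪∁-tight = uncrossˡ _ _ bal (∪∁-pointwise X Y) sepˡ sepʳ tX tY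

    ∪∁-strict : ∀ {e} → e ∈L L →
      δ⁺ (X ∪ᵣ ∁ᵣ Y) e + δ⁺ (Y ∪ᵣ ∁ᵣ X) e + ⟦ ∁ᵣ (X ∪ᵣ Y) (tgt e) ⟧
        < δ⁺ X e + δ⁺ Y e + ⟦ ∁ᵣ (X ∪ᵣ Y) (src e) ⟧ → ⊥
    ∪∁-strict = uncross-strict _ _ bal (∪∁-pointwise X Y) sepˡ sepʳ tX tY

  -- Tight regions that separate the two ends of one arc.

  module AtArc {e : W} (e∈L : e ∈L L) where

    private
      u v : Fin n
      u = src e
      v = tgt e

    record Leaves (i : I) (X : Region n) : Set where
      constructor leaves
      field
        isTight : Tight i X
        u∈X     : X u ≡ true
        v∉X     : X v ≡ false

    record Enters (i : I) (Y : Region n) : Set where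
      constructor enters
      field
        isTight : Tight i Y
        u∉Y     : Y u ≡ false
        v∈Y     : Y v ≡ true

    -- In the opposite positions `e` leaves `X` and `Z` but neither of the two uncrossed regions,
    -- which makes the inequality strict. In the nested positions the union is tight for the pair
    -- with the smaller sink side; that side lies in `B i`, so it avoids `v` with nothing assumed
    -- about `B j`.
    leaves-∪ : ∀ {i j X Z} → Leaves i X → B i v ≡ false → Leaves j Z →
      ∃₂ λ k U → Leaves k U × B k v ≡ false × X ⊑ U × Z ⊑ U
    leaves-∪ {i} {j} {X} {Z} (leaves tX uX vX) v∉B (leaves tZ uZ vZ) with laminar i j
    ... | inj₁ (Ai⊑Aj , Bj⊑Bi) =
      j , X ∪ᵣ Z , leaves (Nested.∪-tight Ai⊑Aj Bj⊑Bi tX tZ) (∨-trueˡ uX) (not-true (∨-false vX vZ))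
      , contrapose Bj⊑Bi v∉B , (λ _ → ∨-trueˡ) , (λ _ → ∨-trueʳ)
    ... | inj₂ (inj₁ (Ai⊑Bj , Aj⊑Bi)) = ⊥-elim (Disjoint.∖-strict Ai⊑Bj Aj⊑Bi tX tZ e∈L strict)
      where
      strict : δ⁺ (X ∖ᵣ Z) e + δ⁺ (Z ∖ᵣ X) e + ⟦ (X ∩ᵣ Z) u ⟧ < δ⁺ X e + δ⁺ Z e + ⟦ (X ∩ᵣ Z) v ⟧
      strict rewrite uX | vX | uZ | vZ = ≤-refl
    ... | inj₂ (inj₂ (inj₁ (Aj⊑Ai , Bi⊑Bj))) =
      i , Z ∪ᵣ X , leaves (Nested.∪-tight Aj⊑Ai Bi⊑Bj tZ tX) (∨-trueˡ uZ) (not-true (∨-false vZ vX))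
      , v∉B , (λ _ → ∨-trueʳ) , (λ _ → ∨-trueˡ)
    ... | inj₂ (inj₂ (inj₂ (Bj⊑Ai , Bi⊑Aj))) = ⊥-elim (Codisjoint.∪∁-strict Bj⊑Ai Bi⊑Aj tX tZ e∈L strict)
      where
      strict : δ⁺ (X ∪ᵣ ∁ᵣ Z) e + δ⁺ (Z ∪ᵣ ∁ᵣ X) e + ⟦ ∁ᵣ (X ∪ᵣ Z) v ⟧ < δ⁺ X e + δ⁺ Z e + ⟦ ∁ᵣ (X ∪ᵣ Z) u ⟧
      strict rewrite uX | vX | uZ | vZ = ≤-refl

    -- Here `e` leaves none of the regions, and in the opposite positions strictness comes from the
    -- corrections alone: `v` lies in both regions and `u` in neither.
    enters-∩ : ∀ {i j Y Z} → Enters i Y → Enters j Z → ∃₂ λ k U → Enters k U × U ⊑ Y × U ⊑ Z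
    enters-∩ {i} {j} {Y} {Z} (enters tY uY vY) (enters tZ uZ vZ) with laminar i j
    ... | inj₁ (Ai⊑Aj , Bj⊑Bi) =
      i , Y ∩ᵣ Z , enters (Nested.∩-tight Ai⊑Aj Bj⊑Bi tY tZ) (not-true (∧-falseˡ uY)) (∧-true vY vZ)
      , (λ _ → ∧-elimˡ) , (λ x → ∧-elimʳ {Y x})
    ... | inj₂ (inj₁ (Ai⊑Bj , Aj⊑Bi)) = ⊥-elim (Disjoint.∖-strict Ai⊑Bj Aj⊑Bi tY tZ e∈L strict)
      where
      strict : δ⁺ (Y ∖ᵣ Z) e + δ⁺ (Z ∖ᵣ Y) e + ⟦ (Y ∩ᵣ Z) u ⟧ < δ⁺ Y e + δ⁺ Z e + ⟦ (Y ∩ᵣ Z) v ⟧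
      strict rewrite uY | vY | uZ | vZ = ≤-refl
    ... | inj₂ (inj₂ (inj₁ (Aj⊑Ai , Bi⊑Bj))) =
      j , Z ∩ᵣ Y , enters (Nested.∩-tight Aj⊑Ai Bi⊑Bj tZ tY) (not-true (∧-falseˡ uZ)) (∧-true vZ vY)
      , (λ x → ∧-elimʳ {Z x}) , (λ _ → ∧-elimˡ)
    ... | inj₂ (inj₂ (inj₂ (Bj⊑Ai , Bi⊑Aj))) = ⊥-elim (Codisjoint.∪∁-strict Bj⊑Ai Bi⊑Aj tY tZ e∈L strict)
      where
      strict : δ⁺ (Y ∪ᵣ ∁ᵣ Z) e + δ⁺ (Z ∪ᵣ ∁ᵣ Y) e + ⟦ ∁ᵣ (Y ∪ᵣ Z) v ⟧ < δ⁺ Y e + δ⁺ Z e + ⟦ ∁ᵣ (Y ∪ᵣ Z) u ⟧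
      strict rewrite uY | vY | uZ | vZ = ≤-refl

    Blocked : W → Set
    Blocked f = (∃₂ λ j Z → Leaves j Z × Z (tgt f) ≡ true) ⊎ (∃₂ λ j Z → Enters j Z × Z (tgt f) ≡ false)

    OutOf : List W → W → Set
    OutOf Q f = f ∈L Q × src f ≡ v

    -- A leaving region is given from the start, an entering one only after an entering witness has
    -- been met; hence two constructors. Unions keep heads that are already inside, intersections
    -- keep heads that are already outside.
    data Cover (Q : List W) : Set where
      leaving : ∀ {i X} → Leaves i X → B i v ≡ false →
        (∀ {f} → OutOf Q f → X (tgt f) ≡ true) → Cover Q
      both : ∀ {i j X Y} → Leaves i X → B i v ≡ false → Enters j Y →
        (∀ {f} → OutOf Q f → X (tgt f) ≡ true ⊎ Y (tgt f) ≡ false) → Cover Q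

    cover : ∀ {i X} → Leaves i X → B i v ≡ false →
      (Q : List W) → (∀ {f} → OutOf Q f → Blocked f) → Cover Q
    cover l v∉B []      blocked = leaving l v∉B λ { (() , _) }
    cover l v∉B (f ∷ Q) blocked with src f ≟ v | cover l v∉B Q (λ (f∈Q , eq) → blocked (there f∈Q , eq))
    ... | no sf≢v | leaving l′ v∉B′ all = leaving l′ v∉B′
      λ { (here refl , eq) → ⊥-elim (sf≢v eq) ; (there g∈Q , eq) → all (g∈Q , eq) }
    ... | no sf≢v | both l′ v∉B′ n all = both l′ v∉B′ n
      λ { (here refl , eq) → ⊥-elim (sf≢v eq) ; (there g∈Q , eq) → all (g∈Q , eq) }
    ... | yes sf≡v | C with blocked (here refl , sf≡v) | C
    ... | inj₁ (_ , _ , lZ , w∈Z) | leaving l′ v∉B′ all =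
      let _ , U , lU , v∉ , X⊑U , Z⊑U = leaves-∪ l′ v∉B′ lZ in leaving lU v∉
      λ { (here refl , _) → Z⊑U _ w∈Z ; (there g∈Q , eq) → X⊑U _ (all (g∈Q , eq)) }
    ... | inj₁ (_ , _ , lZ , w∈Z) | both l′ v∉B′ nY all =
      let _ , U , lU , v∉ , X⊑U , Z⊑U = leaves-∪ l′ v∉B′ lZ in both lU v∉ nY
      λ { (here refl , _) → inj₁ (Z⊑U _ w∈Z) ; (there g∈Q , eq) → map₁ (X⊑U _) (all (g∈Q , eq)) }
    ... | inj₂ (_ , _ , nZ , w∉Z) | leaving l′ v∉B′ all = both l′ v∉B′ nZ
      λ { (here refl , _) → inj₂ w∉Z ; (there g∈Q , eq) → inj₁ (all (g∈Q , eq)) }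
    ... | inj₂ (_ , _ , nZ , w∉Z) | both l′ v∉B′ nY all =
      let _ , U , nU , U⊑Y , U⊑Z = enters-∩ nY nZ in both l′ v∉B′ nU
      λ { (here refl , _) → inj₂ (contrapose U⊑Z w∉Z) ; (there g∈Q , eq) → map₂ (contrapose U⊑Y) (all (g∈Q , eq)) }

    -- Adding `v` to `X` creates no crossing arc, since all arcs out of `v` end in `X`, and it
    -- removes `e` from the cut. As `v` is not in `B i`, the larger region still separates, with a
    -- cut below `κ i`.
    ¬all-out-inside : ∀ {i X} → Leaves i X → B i v ≡ false → (∀ {f} → OutOf L f → X (tgt f) ≡ true) → ⊥
    ¬all-out-inside {i} {X} (leaves tX uX vX) v∉B inside =
      <-irrefl refl (≤-<-trans (lower i X+v sep) (<-≤-trans smaller (minimum tX)))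
      where
      X+v = X ∪ᵣ ｛ v ｝
      ≢v : ∀ {x} → B i x ≡ true → ｛ v ｝ x ≡ false
      ≢v {x} b with x ≟ v
      ... | yes refl = ⊥-elim (true≢false b v∉B)
      ... | no  _    = refl
      sep : Separates (A i) (B i) X+v
      sep = (λ x a → ∨-trueˡ (proj₁ (separates tX) x a))
          , (λ x b → ∨-false (not-true (proj₂ (separates tX) x b)) (≢v b))
      pointwise : ∀ {a} → a ∈L L → δ⁺ X+v a ≤ δ⁺ X a
      pointwise {a} a∈L with src a ≟ v
      ... | yes sa≡v rewrite inside (a∈L , sa≡v) | ∧-zeroʳ (X (src a) ∨ true) = z≤n
      ... | no  _ with X (src a) | X (tgt a) | ｛ v ｝ (tgt a)
      ...   | false | _     | _     = z≤n
      ...   | true  | true  | _     = z≤n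
      ...   | true  | false | true  = z≤n
      ...   | true  | false | false = ≤-refl
      strict : δ⁺ X+v e < δ⁺ X e
      strict rewrite uX | vX | ∈-singleton v = ≤-refl
      smaller : cut X+v < cut X
      smaller = total-mono-< L pointwise e∈L strict

    -- Every arc out of `v` leaves `Y`, and by `balanced` equally many arcs end at `v`. One of
    -- these, `e`, starts outside `Y`, so removing `v` loses more crossing arcs than it gains, and
    -- the cut falls below `κ j`.
    ¬all-out-outside : ∀ {j Y} → Enters j Y → A j v ≡ false →
      total (λ a → ⟦ ｛ v ｝ (src a) ⟧) L ≡ total (λ a → ⟦ ｛ v ｝ (tgt a) ⟧) L →
      (∀ {f} → OutOf L f → Y (tgt f) ≡ false) → ⊥
    ¬all-out-outside {j} {Y} (enters tY uY vY) v∉A balanced avoiding =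
      <-irrefl refl (≤-<-trans (lower j Y-v sep) (<-≤-trans smaller (minimum tY)))
      where
      Y-v = Y ∖ᵣ ｛ v ｝
      ≢v : ∀ {x} → A j x ≡ true → ｛ v ｝ x ≡ false
      ≢v {x} a with x ≟ v
      ... | yes refl = ⊥-elim (true≢false a v∉A)
      ... | no  _    = refl
      sep : Separates (A j) (B j) Y-v
      sep = (λ x a → ∧-true (proj₁ (separates tY) x a) (not-intro (≢v a)))
          , (λ x b → ∧-falseˡ (not-true (proj₂ (separates tY) x b)))
      s t : W → ℕ
      s a = ⟦ ｛ v ｝ (src a) ⟧
      t a = ⟦ ｛ v ｝ (tgt a) ⟧
      pointwise : ∀ {a} → a ∈L L → δ⁺ Y-v a + s a ≤ δ⁺ Y a + t a
      pointwise {a} a∈L with src a ≟ v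
      ... | yes sa≡v rewrite avoiding (a∈L , sa≡v) | sa≡v | vY = s≤s z≤n
      ... | no  _ with Y (src a) | Y (tgt a) | ｛ v ｝ (tgt a)
      ...   | false | _     | _     = z≤n
      ...   | true  | true  | true  = ≤-refl
      ...   | true  | true  | false = ≤-refl
      ...   | true  | false | _     = s≤s z≤n
      strict : δ⁺ Y-v e + s e < δ⁺ Y e + t e
      strict with src e ≟ v
      ... | yes u≡v = ⊥-elim (true≢false vY (trans (cong Y (sym u≡v)) uY))
      ... | no  _ rewrite uY | ∈-singleton v = ≤-refl
      smaller : cut Y-v < cut Y
      smaller = +-cancelʳ-< (total s L) _ _ (begin-strict
        cut Y-v + total s L              ≡⟨ total-+ (δ⁺ Y-v) s L ⟨
        total (λ a → δ⁺ Y-v a + s a) L   <⟨ total-mono-< L pointwise e∈L strict ⟩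
        total (λ a → δ⁺ Y a + t a) L     ≡⟨ total-+ (δ⁺ Y) t L ⟩
        cut Y + total t L                ≡⟨ cong (cut Y +_) balanced ⟨
        cut Y + total s L                ∎)
        where open ≤-Reasoning hiding (strict)

    not-all-blocked : ∀ {i X} → Leaves i X → B i v ≡ false → ¬ (∀ {f} → OutOf L f → Blocked f)
    not-all-blocked l v∉B blocked with cover l v∉B L blocked
    ... | leaving l′ v∉B′ all = ¬all-out-inside l′ v∉B′ all
    ... | both {i} {j} {X} {Y} (leaves tX uX vX) v∉Bi (enters tY uY vY) all with laminar i j
    -- In both nested positions `e` leaves `X` but neither the intersection nor the union, so
    -- submodularity is strict at `e`.
    ...   | inj₁ (Ai⊑Aj , Bj⊑Bi) = Nested.∩∪-strict Ai⊑Aj Bj⊑Bi tX tY e∈L strict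
      where
      strict : δ⁺ (X ∩ᵣ Y) e + δ⁺ (X ∪ᵣ Y) e + 0 < δ⁺ X e + δ⁺ Y e + 0
      strict rewrite uX | vX | uY | vY = ≤-refl
    ...   | inj₂ (inj₂ (inj₁ (Aj⊑Ai , Bi⊑Bj))) = Nested.∩∪-strict Aj⊑Ai Bi⊑Bj tY tX e∈L strict
      where
      strict : δ⁺ (Y ∩ᵣ X) e + δ⁺ (Y ∪ᵣ X) e + 0 < δ⁺ Y e + δ⁺ X e + 0
      strict rewrite uX | vX | uY | vY = ≤-refl
    ...   | inj₂ (inj₁ (Ai⊑Bj , Aj⊑Bi)) =
      ¬all-out-outside
        (enters (Disjoint.∖-tight Ai⊑Bj Aj⊑Bi tX tY) (not-true (∧-falseˡ uY)) (∧-true vY (not-intro vX)))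
        (contrapose Aj⊑Bi v∉Bi)
        (balance i j (inj₁ (Ai⊑Bj , Aj⊑Bi)) ｛ v ｝ λ x p → subst (Outside _ _ _ _) (sym (singleton-elim p)) v-outside)
        λ {f} out → case all out of λ
          { (inj₁ w∈X) → not-true (∧-falseʳ {Y (tgt f)} (cong not w∈X))
          ; (inj₂ w∉Y) → not-true (∧-falseˡ w∉Y) }
      where
      v-outside : Outside (A i) (B i) (A j) (B j) v
      -- `v` is outside `X`, inside `Y`, and outside `B i`, which contains `A j`. So it avoids all
      -- four sides and is balanced.
      v-outside = contrapose (proj₁ (separates tX)) vX , v∉Bi , contrapose Aj⊑Bi v∉Bi
                , contrapose (proj₂ (separates tY)) (cong not vY)
    ...   | inj₂ (inj₂ (inj₂ (Bj⊑Ai , Bi⊑Aj))) =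
      ¬all-out-inside
        (leaves (Codisjoint.∪∁-tight Bj⊑Ai Bi⊑Aj tX tY) (∨-trueˡ uX) (not-true (∨-false vX (cong not vY))))
        v∉Bi
        λ out → case all out of λ
          { (inj₁ w∈X) → ∨-trueˡ w∈X
          ; (inj₂ w∉Y) → ∨-trueʳ (not-intro w∉Y) }

-- Searching lists, minimum cuts, and the invariant of splitting off.

search : {W : Set} {P Q : W → Set} (L : List W) → (∀ {x} → x ∈L L → P x ⊎ Q x) →
  (∃ λ x → x ∈L L × P x) ⊎ (∀ {x} → x ∈L L → Q x)
search []      dec = inj₂ λ ()
search (x ∷ L) dec with dec (here refl)
... | inj₁ p = inj₁ (x , here refl , p)
... | inj₂ q with search L (dec ∘ there)
...   | inj₁ (y , y∈L , p) = inj₁ (y , there y∈L , p)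
...   | inj₂ qs            = inj₂ λ { (here refl) → q ; (there y∈L) → qs y∈L }

extract : {W : Set} {x : W} {L : List W} → x ∈L L → ∃ λ R → L ↭ x ∷ R
extract {x = x} x∈L with ys , zs , refl ← ∈-∃++ x∈L = ys ++ zs , shift x ys zs

total-↭ : {W : Set} (f : W → ℕ) {K L : List W} → K ↭ L → total f K ≡ total f L
total-↭ f p = sum-↭ (map⁺ f p)

-- Branch on whether the first node belongs to the region. The argument `ext` stands in for function
-- extensionality, since regions are functions.
minimiser : ∀ {n} (f : Region n → ℕ) → (∀ {X Y} → X ≗ Y → f X ≡ f Y) → ∃ λ X → ∀ Y → f X ≤ f Y
minimiser {zero}  f ext = (λ ()) , λ Y → ≤-reflexive (ext λ ())
minimiser {suc n} f ext
  with minimiser (f ∘ (true Vector.∷_)) (ext ∘ cons)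
     | minimiser (f ∘ (false Vector.∷_)) (ext ∘ cons)
  where
  cons : ∀ {b} {X Y : Region n} → X ≗ Y → (b Vector.∷ X) ≗ (b Vector.∷ Y)
  cons X≗Y zero    = refl
  cons X≗Y (suc x) = X≗Y x
... | X , minX | Y , minY with ≤-total (f (true Vector.∷ X)) (f (false Vector.∷ Y))
...   | inj₁ X≤Y = true Vector.∷ X , below
  where
  below : ∀ Z → f (true Vector.∷ X) ≤ f Z
  below Z with Z zero in eq
  ... | true  = ≤-trans (minX (Z ∘ suc)) (≤-reflexive (ext λ { zero → sym eq ; (suc _) → refl }))
  ... | false = ≤-trans X≤Y (≤-trans (minY (Z ∘ suc)) (≤-reflexive (ext λ { zero → sym eq ; (suc _) → refl })))
...   | inj₂ Y≤X = false Vector.∷ Y , below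
  where
  below : ∀ Z → f (false Vector.∷ Y) ≤ f Z
  below Z with Z zero in eq
  ... | false = ≤-trans (minY (Z ∘ suc)) (≤-reflexive (ext λ { zero → sym eq ; (suc _) → refl }))
  ... | true  = ≤-trans Y≤X (≤-trans (minX (Z ∘ suc)) (≤-reflexive (ext λ { zero → sym eq ; (suc _) → refl })))

∁-involutive : ∀ {n} (X : Region n) → X ⊑ ∁ᵣ (∁ᵣ X)
∁-involutive X x p rewrite p = refl

module _ {W : Set} {n : ℕ} (src tgt : W → Fin n) where

  cutSize-cong : ∀ {X Y} → X ≗ Y → ∀ L → cutSize src tgt X L ≡ cutSize src tgt Y L
  cutSize-cong X≗Y = total-cong λ a → cong₂ (λ p q → ⟦ p ∧ not q ⟧) (X≗Y (src a)) (X≗Y (tgt a))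

  cutSize-∁ : ∀ X L → cutSize tgt src (∁ᵣ X) L ≡ cutSize src tgt X L
  cutSize-∁ X = total-cong λ a → flip (X (src a)) (X (tgt a))
    where
    flip : ∀ p q → ⟦ not q ∧ not (not p) ⟧ ≡ ⟦ p ∧ not q ⟧
    flip true  true  = refl
    flip true  false = refl
    flip false true  = refl
    flip false false = refl

  minimumCut : ∀ {A B : Region n} → A ⊑ ∁ᵣ B → (L : List W) →
    ∃ λ X → Separates A B X × (∀ Y → Separates A B Y → cutSize src tgt X L ≤ cutSize src tgt Y L)
  minimumCut {A} {B} disjoint L =
    let X , min = minimiser (λ Z → cutSize src tgt (clamp Z) L)
                    (λ X≗Y → cutSize-cong (λ x → cong (λ b → (b ∨ A x) ∧ not (B x)) (X≗Y x)) L)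
    in clamp X
     , ((λ x a → ∧-true (∨-trueʳ a) (disjoint x a)) , λ x b → ∧-falseʳ {X x ∨ A x} (cong not b))
     , λ Y sep → ≤-trans (min Y) (≤-reflexive (cutSize-cong (clamp-id Y sep) L))
    where
    -- clamp maps onto the separating regions, so that all regions can be searched without a side condition.
    clamp : Region n → Region n
    clamp Z = (Z ∪ᵣ A) ∖ᵣ B
    clamp-id : ∀ Y → Separates A B Y → clamp Y ≗ Y
    clamp-id Y (A⊑Y , B⊑∁Y) x with Y x in Yx | A x in Ax | B x in Bx
    ... | true  | _     | false = refl
    ... | true  | _     | true  = ⊥-elim (true≢false Yx (not-true (B⊑∁Y x Bx)))
    ... | false | false | _     = refl
    ... | false | true  | _     = ⊥-elim (true≢false (A⊑Y x Ax) Yx)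

  -- `E` will be the Eulerian condition of the original network. Stating balance for regions inside
  -- `E` gives single nodes and the intersections met in uncrossing at once.
  record Invariant {k : ℕ} (A B : Fin k → Region n) (κ : Fin k → ℕ) (E : Fin n → Set) (L : List W) : Set where
    field
      lower   : ∀ i X → Separates (A i) (B i) X → κ i ≤ cutSize src tgt X L
      balance : ∀ (Z : Region n) → (∀ x → Z x ≡ true → E x) →
        total (λ a → ⟦ Z (src a) ⟧) L ≡ total (λ a → ⟦ Z (tgt a) ⟧) L

-- Reversed arcs leave a region exactly where the original arcs leave its complement, and
-- complements separate the exchanged pair.
reverse : ∀ {W : Set} {n k} {src tgt : W → Fin n} {A B : Fin k → Region n} {κ E L} →
  Invariant src tgt A B κ E L → Invariant tgt src B A κ E L
reverse {src = src} {tgt} {L = L} inv = record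
  { lower   = λ i X (B⊑X , A⊑∁X) → ≤-trans (lower i (∁ᵣ X) (A⊑∁X , λ x b → ∁-involutive X x (B⊑X x b)))
                                         (≤-reflexive (cutSize-∁ tgt src X L))
  ; balance = λ Z Z⊑E → sym (balance Z Z⊑E)
  }
  where open Invariant inv

-- Splitting off a pair of consecutive arcs.

module SplitOff {W : Set} {n : ℕ} (src tgt : W → Fin n)
  (glue : ∀ e f → tgt e ≡ src f → W)
  (src-glue : ∀ e f p → src (glue e f p) ≡ src e)
  (tgt-glue : ∀ e f p → tgt (glue e f p) ≡ tgt f)
  {k : ℕ} (A B : Fin k → Region n) (κ : Fin k → ℕ) (E : Fin n → Set)
  (disjoint : ∀ i → A i ⊑ ∁ᵣ (B i))
  (laminar : ∀ i j → LaminarPair (A i) (B i) (A j) (B j))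
  (eulerian : ∀ i j → Opposite (A i) (B i) (A j) (B j) → ∀ x → Outside (A i) (B i) (A j) (B j) x → E x)
  where

  glue-balance : ∀ {e f p R} (Z : Region n) →
    total (λ a → ⟦ Z (src a) ⟧) (e ∷ f ∷ R) ≡ total (λ a → ⟦ Z (tgt a) ⟧) (e ∷ f ∷ R) →
    total (λ a → ⟦ Z (src a) ⟧) (glue e f p ∷ R) ≡ total (λ a → ⟦ Z (tgt a) ⟧) (glue e f p ∷ R)
  glue-balance {e} {f} {p} {R} Z eq rewrite src-glue e f p | tgt-glue e f p | p = +-cancelʳ-≡ v _ _ (begin
    u + S + v      ≡⟨ +-assoc u S v ⟩
    u + (S + v)    ≡⟨ cong (u +_) (+-comm S v) ⟩
    u + (v + S)    ≡⟨ eq ⟩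
    v + (w + T′)   ≡⟨ +-comm v _ ⟩
    w + T′ + v     ∎)
    where
    open ≡-Reasoning
    u = ⟦ Z (src e) ⟧
    v = ⟦ Z (src f) ⟧
    w = ⟦ Z (tgt f) ⟧
    S = total (λ a → ⟦ Z (src a) ⟧) R
    T′ = total (λ a → ⟦ Z (tgt a) ⟧) R

  glue-cut-≤ : ∀ {e f p R} X → cutSize src tgt X (glue e f p ∷ R) ≤ cutSize src tgt X (e ∷ f ∷ R)
  glue-cut-≤ {e} {f} {p} {R} X rewrite src-glue e f p | tgt-glue e f p | p
    with X (src e) | X (src f) | X (tgt f)
  ... | true  | true  | true  = ≤-refl
  ... | true  | true  | false = ≤-refl
  ... | true  | false | true  = n≤1+n _
  ... | true  | false | false = ≤-refl
  ... | false | true  | true  = ≤-refl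
  ... | false | true  | false = n≤1+n _
  ... | false | false | _     = ≤-refl

  Decreased : Region n → W → W → Set
  Decreased X e f = (X (src e) ≡ true × X (tgt e) ≡ false × X (tgt f) ≡ true)
                  ⊎ (X (src e) ≡ false × X (tgt e) ≡ true × X (tgt f) ≡ false)

  -- Replacing u → v → w by u → w changes the count only when `u` and `w` are on one side and `v` on
  -- the other; then exactly one crossing is lost.
  glue-cut-< : ∀ {e f p R} X → cutSize src tgt X (glue e f p ∷ R) < cutSize src tgt X (e ∷ f ∷ R) →
    Decreased X e f × cutSize src tgt X (e ∷ f ∷ R) ≤ suc (cutSize src tgt X (glue e f p ∷ R))
  glue-cut-< {e} {f} {p} {R} X lt rewrite src-glue e f p | tgt-glue e f p | p
    with X (src e) | X (src f) | X (tgt f)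
  ... | true  | true  | true  = ⊥-elim (<-irrefl refl lt)
  ... | true  | true  | false = ⊥-elim (<-irrefl refl lt)
  ... | true  | false | true  = inj₁ (refl , refl , refl) , ≤-refl
  ... | true  | false | false = ⊥-elim (<-irrefl refl lt)
  ... | false | true  | true  = ⊥-elim (<-irrefl refl lt)
  ... | false | true  | false = inj₂ (refl , refl , refl) , ≤-refl
  ... | false | false | _     = ⊥-elim (<-irrefl refl lt)

  module _ {L : List W} (inv : Invariant src tgt A B κ E L) where

    open Invariant inv

    private
      balance-outside : ∀ i j → Opposite (A i) (B i) (A j) (B j) →
        ∀ (Z : Region n) → (∀ x → Z x ≡ true → Outside (A i) (B i) (A j) (B j) x) →
        total (λ a → ⟦ Z (src a) ⟧) L ≡ total (λ a → ⟦ Z (tgt a) ⟧) L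
      balance-outside i j opp Z out = balance Z λ x Zx → eulerian i j opp x (out x Zx)

    open Uncrossing src tgt A B κ L laminar lower balance-outside

    SplitAt : W → W → Set
    SplitAt e f = Σ (tgt e ≡ src f) λ p → ∃ λ R → L ↭ e ∷ f ∷ R × Invariant src tgt A B κ E (glue e f p ∷ R)

    module _ {e : W} (e∈L : e ∈L L) where

      open AtArc e∈L

      -- If gluing breaks the bound for some `i`, a violating region lost a crossing. It lost only
      -- one, so it was tight before, and its position relative to the three nodes makes it a
      -- witness.
      splitOrBlocked : ∀ {f R} → L ↭ e ∷ f ∷ R → tgt e ≡ src f → SplitAt e f ⊎ Blocked f
      splitOrBlocked {f} {R} L↭ p
        with search {P = λ i → ∃ λ X → Separates (A i) (B i) X × cutSize src tgt X L′ < κ i}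
                    {Q = λ i → ∀ X → Separates (A i) (B i) X → κ i ≤ cutSize src tgt X L′}
                    (allFin k) (λ {i} _ → decide i)
        where
        L′ = glue e f p ∷ R
        decide : ∀ i → (∃ λ X → Separates (A i) (B i) X × cutSize src tgt X L′ < κ i)
                     ⊎ (∀ X → Separates (A i) (B i) X → κ i ≤ cutSize src tgt X L′)
        decide i with X , sep , min ← minimumCut src tgt (disjoint i) L′ with κ i ≤? cutSize src tgt X L′
        ... | yes κ≤ = inj₂ λ Y sepY → ≤-trans κ≤ (min Y sepY)
        ... | no  κ≰ = inj₁ (X , sep , ≰⇒> κ≰)
      ... | inj₂ lower′ = inj₁ (p , R , L↭ , record
        { lower   = λ i → lower′ (∈-allFin i)
        ; balance = λ Z Z⊑E → glue-balance {e} {f} {p} {R} Z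
            (trans (sym (total-↭ _ L↭)) (trans (balance Z Z⊑E) (total-↭ _ L↭)))
        })
      ... | inj₁ (i , _ , X , sep , cut<κ)
        with dec , drop ← glue-cut-< {e} {f} {p} {R} X
               (<-≤-trans cut<κ (≤-trans (lower i X sep) (≤-reflexive (total-↭ _ L↭)))) =
        inj₂ (case dec of λ
          { (inj₁ (uX , vX , wX)) → inj₁ (i , X , leaves tX uX vX , wX)
          ; (inj₂ (uX , vX , wX)) → inj₂ (i , X , enters tX uX vX , wX) })
        where
        tX : Tight i X
        tX = tight sep (≤-trans (≤-reflexive (total-↭ _ L↭)) (≤-trans drop cut<κ))

      splitOff : ∀ {i X} → Separates (A i) (B i) X → cutSize src tgt X L ≤ κ i →
        X (src e) ≡ true → X (tgt e) ≡ false → B i (tgt e) ≡ false → ∃ (SplitAt e)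
      splitOff {i} {X} sep min uX vX v∉B with extract e∈L
      -- The second alternative of `search` is no mere negation: each failed partner supplies its
      -- blocking region.
      ... | R , L↭ with search {P = SplitAt e} {Q = λ f → src f ≡ tgt e → Blocked f} R decide
        where
        decide : ∀ {f} → f ∈L R → SplitAt e f ⊎ (src f ≡ tgt e → Blocked f)
        decide {f} f∈R with src f ≟ tgt e
        ... | no  sf≢v = inj₂ λ sf≡v → ⊥-elim (sf≢v sf≡v)
        ... | yes sf≡v with R′ , R↭ ← extract f∈R =
          map₂ (λ b _ → b) (splitOrBlocked (↭-trans L↭ (prep e R↭)) (sym sf≡v))
      ...   | inj₁ (f , _ , split) = f , split
      ...   | inj₂ blocked = ⊥-elim
        (not-all-blocked (leaves (tight sep min) uX vX) v∉B λ (f∈L , sf≡v) → block (∈-resp-↭ L↭ f∈L) sf≡v)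
        where
        block : ∀ {f} → f ∈L e ∷ R → src f ≡ tgt e → Blocked f
        -- `e` is not a partner for itself: its ends lie on different sides of `X`, so it is no
        -- loop.
        block (here refl) sf≡v = ⊥-elim (true≢false uX (trans (cong X sf≡v) vX))
        block (there f∈R) sf≡v = blocked f∈R sf≡v

-- Splitting off until every minimum cut is crossed only by direct walks.

LaminarPair-swap : ∀ {n} {A B A′ B′ : Region n} → LaminarPair A B A′ B′ → LaminarPair B A B′ A′
LaminarPair-swap (inj₁ (p , q))               = inj₂ (inj₂ (inj₁ (q , p)))
LaminarPair-swap (inj₂ (inj₁ (p , q)))        = inj₂ (inj₂ (inj₂ (q , p)))
LaminarPair-swap (inj₂ (inj₂ (inj₁ (p , q)))) = inj₁ (q , p)
LaminarPair-swap (inj₂ (inj₂ (inj₂ (p , q)))) = inj₂ (inj₁ (q , p))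

-- The regions `M i` are fixed once: gluing never increases a cut, so they remain minimum. `P` is a
-- further property preserved by gluing, later the capacity bound.
module Locking {W : Set} {n : ℕ} (src tgt : W → Fin n)
  (glue : ∀ e f → tgt e ≡ src f → W)
  (src-glue : ∀ e f p → src (glue e f p) ≡ src e)
  (tgt-glue : ∀ e f p → tgt (glue e f p) ≡ tgt f)
  {k : ℕ} (A B : Fin k → Region n) (κ : Fin k → ℕ) (E : Fin n → Set)
  (disjoint : ∀ i → A i ⊑ ∁ᵣ (B i))
  (laminar : ∀ i j → LaminarPair (A i) (B i) (A j) (B j))
  (eulerian : ∀ i j → Opposite (A i) (B i) (A j) (B j) → ∀ x → Outside (A i) (B i) (A j) (B j) x → E x)
  (M : Fin k → Region n)
  (M-separates : ∀ i → Separates (A i) (B i) (M i))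
  (P : List W → Set)
  (P-glue : ∀ {e f R L} p → L ↭ e ∷ f ∷ R → P L → P (glue e f p ∷ R))
  where

  private
    module Forward = SplitOff src tgt glue src-glue tgt-glue A B κ E disjoint laminar eulerian

    -- Reversing all arcs and complementing all regions exchanges the two sides of every partial cut.
    module Backward = SplitOff tgt src (λ e f p → glue f e (sym p))
      (λ e f p → tgt-glue f e (sym p)) (λ e f p → src-glue f e (sym p))
      B A κ E (λ i x b → not-intro (contrapose {X = A i} {Y = ∁ᵣ (B i)} (disjoint i) (cong not b)))
      (λ i j → LaminarPair-swap (laminar i j))
      (λ i j opp x (b , a , b′ , a′) → eulerian i j (swap opp) x (a , b , a′ , b′))

  record State (L : List W) : Set where
    field
      invariant : Invariant src tgt A B κ E L
      M-minimum : ∀ i → cutSize src tgt (M i) L ≤ κ i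
      property  : P L

  Crosses Direct Indirect : Fin k → W → Set
  Crosses  i e = M i (src e) ≡ true × M i (tgt e) ≡ false
  Direct   i e = Crosses i e → A i (src e) ≡ true × B i (tgt e) ≡ true
  Indirect i e = Crosses i e × (A i (src e) ≡ false ⊎ B i (tgt e) ≡ false)

  direct? : ∀ i e → Indirect i e ⊎ Direct i e
  direct? i e with M i (src e) in Mu | M i (tgt e) in Mv | A i (src e) in Au | B i (tgt e) in Bv
  ... | true  | false | true  | true  = inj₂ λ _ → refl , refl
  ... | true  | false | true  | false = inj₁ ((refl , refl) , inj₂ refl)
  ... | true  | false | false | _     = inj₁ ((refl , refl) , inj₁ refl)
  ... | true  | true  | _     | _     = inj₂ λ { (_ , ()) }
  ... | false | _     | _     | _     = inj₂ λ { (() , _) }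

  glueState : ∀ {e f R L} p → L ↭ e ∷ f ∷ R → Invariant src tgt A B κ E (glue e f p ∷ R) →
    State L → State (glue e f p ∷ R)
  glueState {e} {f} {R} p L↭ inv state = record
    { invariant = inv
    ; M-minimum = λ i → ≤-trans (Forward.glue-cut-≤ {e} {f} {p} {R} (M i))
                              (≤-trans (≤-reflexive (sym (total-↭ _ L↭))) (State.M-minimum state i))
    ; property  = P-glue p L↭ (State.property state)
    }

  shorten : ∀ {L i e} → State L → e ∈L L → Indirect i e → ∃ λ L′ → State L′ × suc (length L′) ≡ length L
  shorten {L} {i} state e∈L ((Mu , Mv) , inj₂ v∉B)
    with f , p , R , L↭ , inv ← Forward.splitOff (State.invariant state) e∈L
           (M-separates i) (State.M-minimum state i) Mu Mv v∉B =
    _ , glueState p L↭ inv state , sym (↭-length L↭)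
  shorten {L} {i} {e} state e∈L ((Mu , Mv) , inj₁ u∉A)
    -- The reversed arc leaves the complement of `M i` and ends at `u`; there `A i` is the sink
    -- side, so `u∉A` is the condition required.
    with f , p , R , L↭ , inv ← Backward.splitOff (reverse (State.invariant state)) e∈L {i} {∁ᵣ (M i)}
           (proj₂ (M-separates i) , λ x a → ∁-involutive (M i) x (proj₁ (M-separates i) x a))
           (≤-trans (≤-reflexive (cutSize-∁ src tgt (M i) L)) (State.M-minimum state i))
           (not-intro Mv) (cong not Mu) u∉A =
    -- In original orientation the partner `f` comes before `e`, hence the transposition.
    _ , glueState (sym p) (↭-trans L↭ (_↭_.swap e f ↭-refl)) (reverse inv) state , sym (↭-length L↭)

  -- Each splitting shortens the list by one, so the recursion runs on its length.
  locked : ∀ {L} → State L → ∃ λ L′ → State L′ × (∀ i {e} → e ∈L L′ → Direct i e)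
  locked {L} = go (length L) refl
    where
    go : ∀ l {L} → length L ≡ l → State L → ∃ λ L′ → State L′ × (∀ i {e} → e ∈L L′ → Direct i e)
    go l {L} len state
      with search {P = λ i → ∃ λ e → e ∈L L × Indirect i e} {Q = λ i → ∀ {e} → e ∈L L → Direct i e}
                  (allFin k) (λ {i} _ → search L λ {e} _ → direct? i e)
    ... | inj₂ direct = L , state , λ i → direct (∈-allFin i)
    ... | inj₁ (i , _ , e , e∈L , indirect) with shorten state e∈L indirect | l
    ...   | L′ , state′ , len′ | zero  = case trans len′ len of λ ()
    ...   | L′ , state′ , len′ | suc l = go l (suc-injective (trans len′ len)) state′

-- Finite sums of natural and rational numbers.

sumFin-cong : ∀ {k} {f g : Fin k → ℕ} → (∀ i → f i ≡ g i) → sumFin f ≡ sumFin g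
sumFin-cong {zero}  f≗g = refl
sumFin-cong {suc k} f≗g = cong₂ _+_ (f≗g zero) (sumFin-cong (f≗g ∘ suc))

sumFin-0 : ∀ k → sumFin {k} (λ _ → 0) ≡ 0
sumFin-0 zero    = refl
sumFin-0 (suc k) = sumFin-0 k

sumFin-+ : ∀ {k} (f g : Fin k → ℕ) → sumFin (λ i → f i + g i) ≡ sumFin f + sumFin g
sumFin-+ {zero}  f g = refl
sumFin-+ {suc k} f g = trans (cong (f zero + g zero +_) (sumFin-+ (f ∘ suc) (g ∘ suc)))
                             (interchange +-commutativeSemigroup (f zero) (g zero) _ _)

sumFin-swap : ∀ {k l} (f : Fin k → Fin l → ℕ) → sumFin (λ i → sumFin (f i)) ≡ sumFin (λ j → sumFin (λ i → f i j))
sumFin-swap {zero}  {l} f = sym (sumFin-0 l)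
sumFin-swap {suc k} {l} f = trans (cong (sumFin (f zero) +_) (sumFin-swap (f ∘ suc))) (sym (sumFin-+ (f zero) _))

sumFin-point : ∀ {k} (x : Fin k) (f : Fin k → ℕ) → sumFin (λ i → if ⌊ x ≟ i ⌋ then f i else 0) ≡ f x
sumFin-point {suc k} zero    f = trans (cong (f zero +_) (sumFin-0 k)) (+-identityʳ _)
sumFin-point {suc k} (suc x) f = trans (sumFin-cong peel) (sumFin-point x (f ∘ suc))
  where
  peel : ∀ i → (if ⌊ suc x ≟ suc i ⌋ then f (suc i) else 0) ≡ (if ⌊ x ≟ i ⌋ then f (suc i) else 0)
  peel i with x ≟ i
  ... | yes _ = refl
  ... | no  _ = refl

-- `ℕ→ℚ` reduces fractions to lowest terms; the equation is therefore checked on unnormalised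
-- fractions.
ℕ→ℚ-+ : ∀ a b → ℕ→ℚ (a + b) ≡ ℕ→ℚ a +ℚ ℕ→ℚ b
ℕ→ℚ-+ a b = ℚ.toℚᵘ-injective (begin
  ℚ.toℚᵘ (ℕ→ℚ (a + b))                     ≈⟨ ℚ.toℚᵘ-fromℚᵘ (frac (a + b)) ⟩
  frac (a + b)
    ≈⟨ ℚᵘ.*≡* (cong (ℤ._* ℤ.+ 1) (sym (cong₂ ℤ._+_ (ℤ.*-identityʳ (ℤ.+ a)) (ℤ.*-identityʳ (ℤ.+ b))))) ⟩
  frac a ℚᵘ.+ frac b                       ≈⟨ ℚᵘ.+-cong (ℚ.toℚᵘ-fromℚᵘ (frac a)) (ℚ.toℚᵘ-fromℚᵘ (frac b)) ⟨
  ℚ.toℚᵘ (ℕ→ℚ a) ℚᵘ.+ ℚ.toℚᵘ (ℕ→ℚ b)      ≈⟨ ℚ.toℚᵘ-homo-+ (ℕ→ℚ a) (ℕ→ℚ b) ⟨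
  ℚ.toℚᵘ (ℕ→ℚ a +ℚ ℕ→ℚ b)                 ∎)
  where
  open ℚᵘ.≃-Reasoning
  frac : ℕ → ℚᵘ.ℚᵘ
  -- The second argument is the denominator minus one.
  frac k = ℚᵘ.mkℚᵘ (ℤ.+ k) 0

ℕ→ℚ-nonNeg : ∀ a → 0ℚ ≤ℚ ℕ→ℚ a
ℕ→ℚ-nonNeg a = ℚ.nonNegative⁻¹ (ℕ→ℚ a) {{ℚ.normalize-nonNeg a 1}}

ℕ→ℚ-mono : ∀ {a b} → a ≤ b → ℕ→ℚ a ≤ℚ ℕ→ℚ b
ℕ→ℚ-mono {a} a≤b with c , refl ← m≤n⇒∃[o]m+o≡n a≤b = begin
  ℕ→ℚ a              ≡⟨ ℚ.+-identityʳ (ℕ→ℚ a) ⟨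
  ℕ→ℚ a +ℚ 0ℚ        ≤⟨ ℚ.+-monoʳ-≤ (ℕ→ℚ a) (ℕ→ℚ-nonNeg c) ⟩
  ℕ→ℚ a +ℚ ℕ→ℚ c     ≡⟨ ℕ→ℚ-+ a c ⟨
  ℕ→ℚ (a + c)        ∎
  where open ℚ.≤-Reasoning

sumFinℚ : ∀ {k} → (Fin k → ℚ) → ℚ
sumFinℚ {zero}  f = 0ℚ
sumFinℚ {suc k} f = f zero +ℚ sumFinℚ (f ∘ suc)

sumFinℚ-mono : ∀ {k} {f g : Fin k → ℚ} → (∀ i → f i ≤ℚ g i) → sumFinℚ f ≤ℚ sumFinℚ g
sumFinℚ-mono {zero}  f≤g = ℚ.≤-refl
sumFinℚ-mono {suc k} f≤g = ℚ.+-mono-≤ (f≤g zero) (sumFinℚ-mono (f≤g ∘ suc))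

sumFinℚ-nonNeg : ∀ {k} {f : Fin k → ℚ} → (∀ i → 0ℚ ≤ℚ f i) → 0ℚ ≤ℚ sumFinℚ f
sumFinℚ-nonNeg {zero}  0≤f = ℚ.≤-refl
sumFinℚ-nonNeg {suc k} 0≤f = ℚ.+-mono-≤ (0≤f zero) (sumFinℚ-nonNeg (0≤f ∘ suc))

sumFinℚ-term : ∀ {k} {f : Fin k → ℚ} → (∀ i → 0ℚ ≤ℚ f i) → ∀ i → f i ≤ℚ sumFinℚ f
sumFinℚ-term {f = f} 0≤f zero =
  ℚ.≤-trans (ℚ.≤-reflexive (sym (ℚ.+-identityʳ (f zero)))) (ℚ.+-monoʳ-≤ (f zero) (sumFinℚ-nonNeg (0≤f ∘ suc)))
sumFinℚ-term {f = f} 0≤f (suc i) =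
  ℚ.≤-trans (ℚ.≤-reflexive (sym (ℚ.+-identityˡ (f (suc i)))))
            (ℚ.+-mono-≤ (0≤f zero) (sumFinℚ-term (0≤f ∘ suc) i))

sumFinℚ-+ : ∀ {k} (f g : Fin k → ℚ) → sumFinℚ (λ i → f i +ℚ g i) ≡ sumFinℚ f +ℚ sumFinℚ g
sumFinℚ-+ {zero}  f g = refl
sumFinℚ-+ {suc k} f g = trans (cong (f zero +ℚ g zero +ℚ_) (sumFinℚ-+ (f ∘ suc) (g ∘ suc)))
  (interchange (CommutativeMonoid.commutativeSemigroup ℚ.+-0-commutativeMonoid) (f zero) (g zero) _ _)

sumFinℚ-ℕ→ℚ : ∀ {k} (f : Fin k → ℕ) → sumFinℚ (ℕ→ℚ ∘ f) ≡ ℕ→ℚ (sumFin f)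
sumFinℚ-ℕ→ℚ {zero}  f = refl
sumFinℚ-ℕ→ℚ {suc k} f = trans (cong (ℕ→ℚ (f zero) +ℚ_) (sumFinℚ-ℕ→ℚ (f ∘ suc))) (sym (ℕ→ℚ-+ (f zero) _))

lookup-⊑ : ∀ {n} {p q : Subset n} → p ⊆ q → lookup p ⊑ lookup q
lookup-⊑ {p = p} p⊆q x x∈p = []=⇒lookup (p⊆q (lookup⇒[]= x p x∈p))

⊑-lookup : ∀ {n} {p q : Subset n} → lookup p ⊑ lookup q → p ⊆ q
⊑-lookup {q = q} p⊑q {x} x∈p = lookup⇒[]= x q (p⊑q x ([]=⇒lookup x∈p))

∉-lookup : ∀ {n} {p : Subset n} {x} → lookup p x ≡ false → x ∉ p
∉-lookup x∉p x∈p = true≢false ([]=⇒lookup x∈p) x∉p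

∉-∪ : ∀ {n} {p q : Subset n} {x} → x ∉ p → x ∉ q → x ∉ p ∪ q
∉-∪ x∉p x∉q = [ x∉p , x∉q ]′ ∘ x∈p∪q⁻ _ _

-- Walks, loop erasure and the initial list of unit arcs.

module Walks (N : Network) where
  open Network N

  occ-++ : ∀ e xs ys → occ N e (xs ++ ys) ≡ occ N e xs + occ N e ys
  occ-++ e []       ys = refl
  occ-++ e (x ∷ xs) ys with e ≟ x
  ... | yes _ = cong suc (occ-++ e xs ys)
  ... | no  _ = occ-++ e xs ys

  occ-∷ : ∀ e x xs → occ N e xs ≤ occ N e (x ∷ xs)
  occ-∷ e x xs with e ≟ x
  ... | yes _ = n≤1+n _
  ... | no  _ = ≤-refl

  occ-∷-mono : ∀ e x {xs ys} → occ N e xs ≤ occ N e ys → occ N e (x ∷ xs) ≤ occ N e (x ∷ ys)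
  occ-∷-mono e x le with e ≟ x
  ... | yes _ = s≤s le
  ... | no  _ = le

  -- Nodes and edges may repeat, as concatenation requires; walks become simple only when the flow
  -- is read off.
  data _⇝_ : Fin n → Fin n → Set where
    []   : ∀ {a} → a ⇝ a
    step : ∀ {a b} e → tail e ≡ a → head e ⇝ b → a ⇝ b

  route : ∀ {a b} → a ⇝ b → List (Fin m)
  route []           = []
  route (step e _ w) = e ∷ route w

  _◅◅_ : ∀ {a b c} → a ⇝ b → b ⇝ c → a ⇝ c
  []          ◅◅ v = v
  step e p w ◅◅ v = step e p (w ◅◅ v)

  route-◅◅ : ∀ {a b c} (w : a ⇝ b) (v : b ⇝ c) → route (w ◅◅ v) ≡ route w ++ route v
  route-◅◅ []           v = refl
  route-◅◅ (step e _ w) v = cong (e ∷_) (route-◅◅ w v)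

  Simple : ∀ {a b} → a ⇝ b → Set
  Simple {a} w = Unique (a ∷ map head (route w))

  -- The bound on occurrences ensures that erasing loops respects capacities.
  SimplifiesTo : ∀ {a b} → List (Fin m) → a ⇝ b → Set
  SimplifiesTo es s = Simple s × (∀ e → occ N e (route s) ≤ occ N e es)

  suffix : ∀ {a b x} (s : a ⇝ b) → x ∈L (a ∷ map head (route s)) → Simple s →
    Σ (x ⇝ b) (SimplifiesTo (route s))
  suffix s            (here refl)  simple       = s , simple , λ _ → ≤-refl
  suffix (step f _ s) (there x∈s) (_ ∷ simple) =
    let t , simple′ , occ≤ = suffix s x∈s simple in t , simple′ , λ e → ≤-trans (occ≤ e) (occ-∷ e f _)

  -- The remainder is made simple first; if the new start already lies on it, only the suffix from
  -- that node is kept.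
  loopErase : ∀ {a b} (w : a ⇝ b) → Σ (a ⇝ b) (SimplifiesTo (route w))
  loopErase []              = [] , ([] ∷ []) , λ _ → ≤-refl
  loopErase (step e refl w) with loopErase w
  ... | s , simple , occ≤ with tail e ∈L? (head e ∷ map head (route s))
    where open DecMembership _≟_ using () renaming (_∈?_ to _∈L?_)
  ...   | no  new = step e refl s , ¬Any⇒All¬ _ new ∷ simple , λ f → occ-∷-mono f e (occ≤ f)
  ...   | yes old =
    let t , simple′ , occ≤′ = suffix s old simple
    in t , simple′ , λ f → ≤-trans (occ≤′ f) (≤-trans (occ≤ f) (occ-∷ f e _))

  route-linked : ∀ {b} e (w : head e ⇝ b) → Linked (λ e f → head e ≡ tail f) (e ∷ route w)
  route-linked e []           = [-]
  route-linked e (step f p w) = sym p ∷ route-linked f w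

  route-end : ∀ {b} e (w : head e ⇝ b) → head (lastEdge N e (route w)) ≡ b
  route-end e []           = refl
  route-end e (step f _ w) = route-end f w

  toPath : ∀ {a b} (w : a ⇝ b) → a ≢ b →
    Σ (Path N) λ p → source p ≡ a × target p ≡ b × (∀ e → occ N e (edges p) ≤ occ N e (route w))
  toPath w a≢b with loopErase w
  -- A `Path` has at least one edge; distinct ends exclude the empty walk.
  ... | []            , _      , _    = ⊥-elim (a≢b refl)
  ... | step e refl s , simple , occ≤ =
    record { first = e ; rest = route s ; linked = route-linked e s ; simple = simple }
    , refl , route-end e s , occ≤

  record Walk : Set where
    constructor walk
    field
      {origin end} : Fin n
      way         : origin ⇝ end
  open Walk public

  glue : (w v : Walk) → end w ≡ origin v → Walk
  glue (walk w) (walk v) refl = walk (w ◅◅ v)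

  origin-glue : ∀ w v p → origin (glue w v p) ≡ origin w
  origin-glue w v refl = refl

  end-glue : ∀ w v p → end (glue w v p) ≡ end v
  end-glue w v refl = refl

  uses : Fin m → Walk → ℕ
  uses e w = occ N e (route (way w))

  uses-glue : ∀ e w v p → uses e (glue w v p) ≡ uses e w + uses e v
  uses-glue e (walk w) (walk v) refl = trans (cong (occ N e) (route-◅◅ w v)) (occ-++ e (route w) (route v))

  copies : ∀ {k} → (Fin k → Walk) → (Fin k → ℕ) → List Walk
  copies {zero}  w r = []
  copies {suc k} w r = replicate (r zero) (w zero) ++ copies (w ∘ suc) (r ∘ suc)

  total-replicate-++ : ∀ (f : Walk → ℕ) w r L → total f (replicate r w ++ L) ≡ r * f w + total f L
  total-replicate-++ f w zero    L = refl
  total-replicate-++ f w (suc r) L = trans (cong (f w +_) (total-replicate-++ f w r L)) (sym (+-assoc (f w) _ _))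

  total-copies : ∀ {k} (f : Walk → ℕ) (w : Fin k → Walk) r → total f (copies w r) ≡ sumFin (λ i → r i * f (w i))
  total-copies {zero}  f w r = refl
  total-copies {suc k} f w r = trans (total-replicate-++ f (w zero) (r zero) _)
                                     (cong (r zero * f (w zero) +_) (total-copies f (w ∘ suc) (r ∘ suc)))

  unitArcs : List Walk
  unitArcs = copies (λ e → walk (step e refl [])) c

  total-unitArcs : (f : Walk → ℕ) → total f unitArcs ≡ sumFin (λ e → c e * f (walk (step e refl [])))
  total-unitArcs f = total-copies f _ c

  WithinCapacity : List Walk → Set
  WithinCapacity L = ∀ e → total (uses e) L ≤ c e

  unitArcs-withinCapacity : WithinCapacity unitArcs
  unitArcs-withinCapacity e = ≤-reflexive (begin
    total (uses e) unitArcs                             ≡⟨ total-unitArcs (uses e) ⟩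
    sumFin (λ f → c f * occ N e (f ∷ []))               ≡⟨ sumFin-cong single ⟩
    sumFin (λ f → if ⌊ e ≟ f ⌋ then c f else 0)         ≡⟨ sumFin-point e c ⟩
    c e                                                 ∎)
    where
    open ≡-Reasoning
    single : ∀ f → c f * occ N e (f ∷ []) ≡ (if ⌊ e ≟ f ⌋ then c f else 0)
    single f with e ≟ f
    ... | yes _ = *-identityʳ (c f)
    ... | no  _ = *-zeroʳ (c f)

  glue-withinCapacity : ∀ {w v R L} p → L ↭ w ∷ v ∷ R → WithinCapacity L → WithinCapacity (glue w v p ∷ R)
  glue-withinCapacity {w} {v} {R} {L} p L↭ cap e = begin
    uses e (glue w v p) + total (uses e) R        ≡⟨ cong (_+ total (uses e) R) (uses-glue e w v p) ⟩
    uses e w + uses e v + total (uses e) R        ≡⟨ +-assoc (uses e w) _ _ ⟩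
    total (uses e) (w ∷ v ∷ R)                    ≡⟨ total-↭ (uses e) L↭ ⟨
    total (uses e) L                              ≤⟨ cap e ⟩
    c e                                           ∎
    where open ≤-Reasoning

  -- Double counting: arcs are grouped by the node at their chosen end, which is `tail` or `head` in
  -- the use below.
  sum-over-region : (Z : Region n) (end : Fin m → Fin n) → sumFin (λ e → c e * ⟦ Z (end e) ⟧) ≡
    sumFin (λ v → if Z v then sumFin (λ e → if ⌊ end e ≟ v ⌋ then c e else 0) else 0)
  sum-over-region Z end = begin
    sumFin (λ e → c e * ⟦ Z (end e) ⟧)
      ≡⟨ sumFin-cong (λ e → sumFin-point (end e) (λ v → c e * ⟦ Z v ⟧)) ⟨
    sumFin (λ e → sumFin (λ v → if ⌊ end e ≟ v ⌋ then c e * ⟦ Z v ⟧ else 0))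
      ≡⟨ sumFin-swap (λ e v → if ⌊ end e ≟ v ⌋ then c e * ⟦ Z v ⟧ else 0) ⟩
    sumFin (λ v → sumFin (λ e → if ⌊ end e ≟ v ⌋ then c e * ⟦ Z v ⟧ else 0))
      ≡⟨ sumFin-cong restrict ⟩
    sumFin (λ v → if Z v then sumFin (λ e → if ⌊ end e ≟ v ⌋ then c e else 0) else 0) ∎
    where
    open ≡-Reasoning
    restrict : ∀ v → sumFin (λ e → if ⌊ end e ≟ v ⌋ then c e * ⟦ Z v ⟧ else 0)
                   ≡ (if Z v then sumFin (λ e → if ⌊ end e ≟ v ⌋ then c e else 0) else 0)
    restrict v with Z v
    ... | true  = sumFin-cong λ e → cong (λ r → if ⌊ end e ≟ v ⌋ then r else 0) (*-identityʳ (c e))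
    ... | false = trans (sumFin-cong λ e → vanish ⌊ end e ≟ v ⌋ (c e)) (sumFin-0 m)
      where
      vanish : ∀ b r → (if b then r * 0 else 0) ≡ 0
      vanish true  r = *-zeroʳ r
      vanish false r = refl

  unitArcs-balance : (Z : Region n) → (∀ v → Z v ≡ true → Eulerian N v) →
    total (λ w → ⟦ Z (origin w) ⟧) unitArcs ≡ total (λ w → ⟦ Z (end w) ⟧) unitArcs
  unitArcs-balance Z Z⊑E = begin
    total (λ w → ⟦ Z (origin w) ⟧) unitArcs          ≡⟨ total-unitArcs _ ⟩
    sumFin (λ e → c e * ⟦ Z (tail e) ⟧)             ≡⟨ sum-over-region Z tail ⟩
    sumFin (λ v → if Z v then outCap N v else 0)    ≡⟨ sumFin-cong eulerian ⟩
    sumFin (λ v → if Z v then inCap N v else 0)     ≡⟨ sum-over-region Z head ⟨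
    sumFin (λ e → c e * ⟦ Z (head e) ⟧)             ≡⟨ total-unitArcs _ ⟨
    total (λ w → ⟦ Z (end w) ⟧) unitArcs            ∎
    where
    open ≡-Reasoning
    eulerian : ∀ v → (if Z v then outCap N v else 0) ≡ (if Z v then inCap N v else 0)
    eulerian v with Z v in Zv
    ... | true  = Z⊑E v Zv
    ... | false = refl

  -- Weak duality: separating regions bound every multiflow.

  module WeakDuality {A B : Subset n} {X : Region n} (separates : Separates (lookup A) (lookup B) X) where

    crosses : Fin m → Bool
    crosses e = X (tail e) ∧ not (X (head e))

    crossingLoad : Flow N → ℚ
    crossingLoad F = sumFinℚ (λ e → if crosses e then load N F e else 0ℚ)

    -- The edge found is the first one whose head is outside `X`.
    crossingEdge : ∀ e es → Linked (λ e f → head e ≡ tail f) (e ∷ es) →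
      X (tail e) ≡ true → X (head (lastEdge N e es)) ≡ false →
      ∃ λ f → crosses f ≡ true × 1 ≤ occ N f (e ∷ es)
    crossingEdge e es linked Xs Xt with X (head e) in Xh
    crossingEdge e es linked Xs Xt | false = e , ∧-true Xs (cong not Xh) , here-once
      where
      here-once : 1 ≤ occ N e (e ∷ es)
      here-once with e ≟ e
      ... | yes _   = s≤s z≤n
      ... | no e≢e = ⊥-elim (e≢e refl)
    crossingEdge e []       linked       Xs Xt | true = ⊥-elim (true≢false Xh Xt)
    crossingEdge e (f ∷ es) (p ∷ linked) Xs Xt | true =
      let g , cross , once = crossingEdge f es linked (trans (cong X (sym p)) Xh) Xt
      in g , cross , ≤-trans once (occ-∷ g e (f ∷ es))

    -- Each path from `A` to `B` uses a crossing edge at least once, so its weight is at most its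
    -- own contribution to the crossing load; the other paths contribute nonnegatively.
    value≤crossingLoad : (F : Flow N) → All (λ pw → 0ℚ ≤ℚ proj₂ pw) F → value N (A , B) F ≤ℚ crossingLoad F
    value≤crossingLoad []            []             = sumFinℚ-nonNeg λ e → ℚ.≤-reflexive (sym (zero-if (crosses e)))
      where
      zero-if : ∀ b → (if b then 0ℚ else 0ℚ) ≡ 0ℚ
      zero-if true  = refl
      zero-if false = refl
    value≤crossingLoad ((p , r) ∷ F) (0≤r ∷ nonNeg) = begin
      (if δ N (A , B) (source p) (target p) then r else 0ℚ) +ℚ value N (A , B) F
        ≤⟨ ℚ.+-mono-≤ path (value≤crossingLoad F nonNeg) ⟩
      sumFinℚ share +ℚ crossingLoad F
        ≡⟨ sumFinℚ-+ share _ ⟨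
      sumFinℚ (λ e → share e +ℚ (if crosses e then load N F e else 0ℚ))
        ≤⟨ sumFinℚ-mono (λ e → ℚ.≤-reflexive (merge (crosses e) _ _)) ⟩
      crossingLoad ((p , r) ∷ F) ∎
      where
      open ℚ.≤-Reasoning
      share : Fin m → ℚ
      share e = if crosses e then r *ℚ ℕ→ℚ (occ N e (edges p)) else 0ℚ
      merge : ∀ b x y → (if b then x else 0ℚ) +ℚ (if b then y else 0ℚ) ≡ (if b then x +ℚ y else 0ℚ)
      merge true  x y = refl
      merge false x y = refl
      instance
        r-nonNeg : ℚ.NonNegative r
        r-nonNeg = ℚ.nonNegative 0≤r
      r*-mono : ∀ {i j} → i ≤ j → r *ℚ ℕ→ℚ i ≤ℚ r *ℚ ℕ→ℚ j
      r*-mono i≤j = ℚ.*-monoˡ-≤-nonNeg r (ℕ→ℚ-mono i≤j)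
      share-nonNeg : ∀ e → 0ℚ ≤ℚ share e
      share-nonNeg e with crosses e
      ... | false = ℚ.≤-refl
      ... | true  = ℚ.≤-trans (ℚ.≤-reflexive (sym (ℚ.*-zeroʳ r))) (r*-mono {0} {occ N e (edges p)} z≤n)
      path : (if δ N (A , B) (source p) (target p) then r else 0ℚ) ≤ℚ sumFinℚ share
      path with lookup A (source p) in s∈A | lookup B (target p) in t∈B
      ... | false | _     = sumFinℚ-nonNeg share-nonNeg
      ... | true  | false = sumFinℚ-nonNeg share-nonNeg
      ... | true  | true
        with f , cross , once ← crossingEdge (first p) (rest p) (linked p)
               (proj₁ separates _ s∈A) (not-true (proj₂ separates _ t∈B)) = begin
        r                                ≡⟨ ℚ.*-identityʳ r ⟨
        r *ℚ ℕ→ℚ 1                       ≤⟨ r*-mono once ⟩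
        r *ℚ ℕ→ℚ (occ N f (edges p))     ≡⟨ cong (λ b → if b then r *ℚ ℕ→ℚ (occ N f (edges p)) else 0ℚ) cross ⟨
        share f                          ≤⟨ sumFinℚ-term share-nonNeg f ⟩
        sumFinℚ share                    ∎

    value≤cut : (F : Flow N) → IsMultiflow N F → value N (A , B) F ≤ℚ ℕ→ℚ (cutSize origin end X unitArcs)
    value≤cut F (valid , capacity) = begin
      value N (A , B) F
        ≤⟨ value≤crossingLoad F (All.map (proj₂ ∘ proj₂ ∘ proj₂) valid) ⟩
      crossingLoad F                                          ≤⟨ sumFinℚ-mono (λ e → bound e) ⟩
      sumFinℚ (λ e → ℕ→ℚ (c e * ⟦ crosses e ⟧))               ≡⟨ sumFinℚ-ℕ→ℚ (λ e → c e * ⟦ crosses e ⟧) ⟩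
      ℕ→ℚ (sumFin (λ e → c e * ⟦ crosses e ⟧))                ≡⟨ cong ℕ→ℚ (total-unitArcs (crossing origin end X)) ⟨
      ℕ→ℚ (cutSize origin end X unitArcs)                      ∎
      where
      open ℚ.≤-Reasoning
      bound : ∀ e → (if crosses e then load N F e else 0ℚ) ≤ℚ ℕ→ℚ (c e * ⟦ crosses e ⟧)
      bound e with crosses e
      ... | true  rewrite *-identityʳ (c e) = capacity e
      ... | false rewrite *-zeroʳ (c e) = ℚ.≤-refl

  -- Reading an integral multiflow off a list of walks.

  JoinsTerminals : Walk → Set
  JoinsTerminals w = origin w ∈ S × end w ∈ S × origin w ≢ end w

  joinsTerminals? : ∀ w → Dec (JoinsTerminals w)
  joinsTerminals? w = (origin w ∈? S) ×-dec ((end w ∈? S) ×-dec ¬? (origin w ≟ end w))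

  -- Splitting can leave walks that are closed or end at non-terminals; these are dropped, and every
  -- other walk carries one unit.
  flowOf : List Walk → Flow N
  flowOf []      = []
  flowOf (w ∷ L) with joinsTerminals? w
  ... | yes (_ , _ , s≢t) = (proj₁ (toPath (way w) s≢t) , 1ℚ) ∷ flowOf L
  ... | no  _             = flowOf L

  flowOf-integral : ∀ L → IsIntegral N (flowOf L)
  flowOf-integral []      = []
  flowOf-integral (w ∷ L) with joinsTerminals? w
  ... | yes _ = (1 , refl) ∷ flowOf-integral L
  ... | no  _ = flowOf-integral L

  flowOf-valid : ∀ L → All (λ pw → (source (proj₁ pw) ∈ S) × (target (proj₁ pw) ∈ S)
                         × (source (proj₁ pw) ≢ target (proj₁ pw)) × (0ℚ ≤ℚ proj₂ pw)) (flowOf L)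
  flowOf-valid []      = []
  flowOf-valid (w ∷ L) with joinsTerminals? w
  ... | no  _               = flowOf-valid L
  ... | yes (s∈S , t∈S , s≢t) with toPath (way w) s≢t
  ...   | p , refl , refl , _ = (s∈S , t∈S , s≢t , ℕ→ℚ-nonNeg 1) ∷ flowOf-valid L

  flowOf-load : ∀ L e → load N (flowOf L) e ≤ℚ ℕ→ℚ (total (uses e) L)
  flowOf-load []      e = ℚ.≤-refl
  flowOf-load (w ∷ L) e with joinsTerminals? w
  ... | no  _ = ℚ.≤-trans (flowOf-load L e) (ℕ→ℚ-mono (m≤n+m _ (uses e w)))
  ... | yes (_ , _ , s≢t) with toPath (way w) s≢t
  ...   | p , _ , _ , occ≤ = begin
    1ℚ *ℚ ℕ→ℚ (occ N e (edges p)) +ℚ load N (flowOf L) e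
      ≡⟨ cong (_+ℚ load N (flowOf L) e) (ℚ.*-identityˡ (ℕ→ℚ (occ N e (edges p)))) ⟩
    ℕ→ℚ (occ N e (edges p)) +ℚ load N (flowOf L) e          ≤⟨ ℚ.+-mono-≤ (ℕ→ℚ-mono (occ≤ e)) (flowOf-load L e) ⟩
    ℕ→ℚ (uses e w) +ℚ ℕ→ℚ (total (uses e) L)                ≡⟨ ℕ→ℚ-+ (uses e w) _ ⟨
    ℕ→ℚ (uses e w + total (uses e) L)                       ∎
    where open ℚ.≤-Reasoning

  joins : Subset n → Subset n → Walk → ℕ
  joins A B w = ⟦ lookup A (origin w) ∧ lookup B (end w) ⟧

  -- A walk from `A` to `B` is never dropped: both sides consist of terminals and they are disjoint.
  -- Loop erasure keeps its ends.
  flowOf-value : ∀ {A B} → IsPartialCut N (A , B) → ∀ L → ℕ→ℚ (total (joins A B) L) ≤ℚ value N (A , B) (flowOf L)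
  flowOf-value {A} {B} _ [] = ℚ.≤-refl
  flowOf-value {A} {B} pc@(A⊆S , B⊆S , disjoint) (w ∷ L) with joinsTerminals? w
  ... | yes (_ , _ , s≢t) with toPath (way w) s≢t
  ...   | p , refl , refl , _ =
    ℚ.≤-trans (ℚ.≤-reflexive (ℕ→ℚ-+ (joins A B w) _))
              (ℚ.+-mono-≤ (unit (lookup A (origin w) ∧ lookup B (end w))) (flowOf-value pc L))
    where
    unit : ∀ b → ℕ→ℚ ⟦ b ⟧ ≤ℚ (if b then 1ℚ else 0ℚ)
    unit true  = ℚ.≤-refl
    unit false = ℚ.≤-refl
  flowOf-value {A} {B} pc@(A⊆S , B⊆S , disjoint) (w ∷ L) | no ¬joins =
    subst (λ r → ℕ→ℚ (r + total (joins A B) L) ≤ℚ _) (sym none) (flowOf-value pc L)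
    where
    none : joins A B w ≡ 0
    none with lookup A (origin w) in s∈A | lookup B (end w) in t∈B
    ... | false | _     = refl
    ... | true  | false = refl
    ... | true  | true  = ⊥-elim (¬joins (A⊆S s∈ , B⊆S t∈ , λ s≡t → disjoint s∈ (subst (_∈ B) (sym s≡t) t∈)))
      where
      s∈ = lookup⇒[]= (origin w) A s∈A
      t∈ = lookup⇒[]= (end w) B t∈B

-- Assembling the locking multiflow.

theorem3p5 : (N : Network) (𝒜 : List (PartialCut N))
    → All (IsPartialCut N) 𝒜
    → Laminar 𝒜
    → InnerEulerian N
    → (∀ s → s ∈ Network.S N → Special 𝒜 s → Eulerian N s)
    → Σ (Flow N) (λ F → IsMultiflow N F × IsIntegral N F × Locks N 𝒜 F)
theorem3p5 N 𝒜 partialCuts laminar inner special = flowOf L , multiflow , flowOf-integral L , locks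
  where
  open Network N
  open Walks N

  AB : Fin (length 𝒜) → PartialCut N
  AB = List.lookup 𝒜

  A B : Fin (length 𝒜) → Region n
  A i = lookup (proj₁ (AB i))
  B i = lookup (proj₂ (AB i))

  partialCut : ∀ i → IsPartialCut N (AB i)
  partialCut i = All.lookup partialCuts (∈-lookup i)

  disjoint : ∀ i → A i ⊑ ∁ᵣ (B i)
  disjoint i x x∈A with B i x in x∈B
  ... | false = refl
  ... | true  = ⊥-elim (proj₂ (proj₂ (partialCut i)) (lookup⇒[]= x _ x∈A) (lookup⇒[]= x _ x∈B))

  lam : ∀ i j → LaminarPair (A i) (B i) (A j) (B j)
  lam i j with laminar (∈-lookup {xs = 𝒜} i) (∈-lookup j)
  ... | inj₁ (p , q)               = inj₁ (lookup-⊑ p , lookup-⊑ q)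
  ... | inj₂ (inj₁ (p , q))        = inj₂ (inj₁ (lookup-⊑ p , lookup-⊑ q))
  ... | inj₂ (inj₂ (inj₁ (p , q))) = inj₂ (inj₂ (inj₁ (lookup-⊑ p , lookup-⊑ q)))
  ... | inj₂ (inj₂ (inj₂ (p , q))) = inj₂ (inj₂ (inj₂ (lookup-⊑ p , lookup-⊑ q)))

  eulerian : ∀ i j → Opposite (A i) (B i) (A j) (B j) → ∀ x → Outside (A i) (B i) (A j) (B j) x → Eulerian N x
  eulerian i j opp x (x∉A , x∉B , x∉A′ , x∉B′) with x ∈? S
  ... | no  x∉S = inner x x∉S
  ... | yes x∈S = special x x∈S
    ( _ , _ , _ , _ , ∈-lookup i , ∈-lookup j
    , ∉-∪ (∉-lookup x∉A) (∉-∪ (∉-lookup x∉B) (∉-∪ (∉-lookup x∉A′) (∉-lookup x∉B′)))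
    , opposite opp )
    where
    opposite : Opposite (A i) (B i) (A j) (B j) →
        (proj₁ (AB i) ⊆ proj₂ (AB j) × proj₁ (AB j) ⊆ proj₂ (AB i))
      ⊎ (proj₂ (AB i) ⊆ proj₁ (AB j) × proj₂ (AB j) ⊆ proj₁ (AB i))
    opposite (inj₁ (p , q)) = inj₁ (⊑-lookup p , ⊑-lookup q)
    opposite (inj₂ (p , q)) = inj₂ (⊑-lookup p , ⊑-lookup q)

  cut₀ : ∀ i → ∃ λ X → Separates (A i) (B i) X ×
    (∀ Y → Separates (A i) (B i) Y → cutSize origin end X unitArcs ≤ cutSize origin end Y unitArcs)
  cut₀ i = minimumCut origin end (disjoint i) unitArcs

  M : Fin (length 𝒜) → Region n
  M i = proj₁ (cut₀ i)

  κ : Fin (length 𝒜) → ℕ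
  κ i = cutSize origin end (M i) unitArcs

  open Locking origin end glue origin-glue end-glue A B κ (Eulerian N) disjoint lam eulerian
    M (λ i → proj₁ (proj₂ (cut₀ i))) WithinCapacity glue-withinCapacity

  result : ∃ λ L → State L × (∀ i {w} → w ∈L L → Direct i w)
  result = locked {unitArcs} record
    { invariant = record { lower = λ i → proj₂ (proj₂ (cut₀ i)) ; balance = unitArcs-balance }
    ; M-minimum = λ i → ≤-refl
    ; property  = unitArcs-withinCapacity
    }

  L = proj₁ result
  open State (proj₁ (proj₂ result))

  multiflow : IsMultiflow N (flowOf L)
  multiflow = flowOf-valid L , λ e → ℚ.≤-trans (flowOf-load L e) (ℕ→ℚ-mono (property e))

  -- By the invariant at least `κ i` walks leave `M i`, and each of them is direct, so it joins
  -- `A i` to `B i`.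
  κ≤joins : ∀ i → κ i ≤ total (joins (proj₁ (AB i)) (proj₂ (AB i))) L
  κ≤joins i = ≤-trans (Invariant.lower invariant i (M i) (proj₁ (proj₂ (cut₀ i))))
                      (total-mono L λ {w} w∈L → joined w (proj₂ (proj₂ result) i w∈L))
    where
    joined : ∀ w → Direct i w → crossing origin end (M i) w ≤ joins (proj₁ (AB i)) (proj₂ (AB i)) w
    joined w direct with M i (origin w) | M i (end w)
    ... | false | _     = z≤n
    ... | true  | true  = z≤n
    ... | true  | false with s∈A , t∈B ← direct (refl , refl) rewrite s∈A | t∈B = ≤-refl

  locks : Locks N 𝒜 (flowOf L)
  -- The capacity `κ i` of `M i` bounds every competing flow, and the constructed flow attains it.
  locks AB∈𝒜 rewrite lookup-index AB∈𝒜 = multiflow , λ F′ isFlow → ℚ.≤-trans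
    (WeakDuality.value≤cut {proj₁ (AB i)} {proj₂ (AB i)} (proj₁ (proj₂ (cut₀ i))) F′ isFlow)
    (ℚ.≤-trans (ℕ→ℚ-mono (κ≤joins i)) (flowOf-value {proj₁ (AB i)} {proj₂ (AB i)} (partialCut i) L))
    where i = index AB∈𝒜
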